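{- Let $0\le\alpha<1$ and let $H_1,H_2$ be two $\alpha$-Erdős–Simonovits good bipartite graphs. Fix $e_1\in E(H_1)$ and $e_2\in E(H_2)$, and let $\mathcal{H}$ be the family of graphs obtained from vertex-disjoint copies of $H_1$ and $H_2$ by identifying the edge $e_1$ with the edge $e_2$ (in either of the two possible ways of matching their endpoints). Then there exist constants $C,\beta>0$ depending only on $H_1,H_2$ such that for every $n$-vertex graph $G$ with $pn^2\ge Cn^{1+\alpha}$ edges, there is some member of $\mathcal{H}$ of which $G$ contains at least $\beta p^{\mathrm{e}(H_1)+\mathrm{e}(H_2)-1}n^{\mathrm{v}(H_1)+\mathrm{v}(H_2)-2}$ copies.
   Context: For a graph $H$, $\mathrm{e}(H)$ and $\mathrm{v}(H)$ denote its numbers of edges and vertices. A bipartite graph $H$ is $(\alpha,C,\beta)$-Erdős–Simonovits good if every graph $G$ on $n$ vertices with $pn^2\ge Cn^{1+\alpha}$ edges contains at least $\beta p^{\mathrm{e}(H)}n^{\mathrm{v}(H)}$ copies of $H$. For $0\le\alpha<1$, $H$ is $\alpha$-Erdős–Simonovits good if it is $(\alpha,C,\beta)$-Erdős–Simonovits good for some positive constants $C,\beta$. -}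

module Defs where

open import Data.Bool using (Bool; true; false; _∧_; not; T)
open import Data.Nat as ℕ using (ℕ; zero; suc)
open import Data.Fin as Fin using (Fin; toℕ)
open import Data.List using (List; []; _∷_; map; concatMap; allFin; length; filterᵇ; cartesianProduct)
open import Data.Product using (Σ; ∃; ∃-syntax; _×_; _,_; proj₁; proj₂)
open import Data.Sum using (_⊎_)
open import Data.Integer using (+_)
open import Data.Rational using (ℚ; _/_; _*_; _-_; _≤_; _<_; 0ℚ; 1ℚ)
open import Relation.Nullary using (¬_)
open import Relation.Nullary.Decidable using (⌊_⌋)
open import Relation.Binary.PropositionalEquality using (_≡_; _≢_)
open import Function.Bundles using (_⇔_)

ℕtoℚ : ℕ → ℚ
ℕtoℚ n = + n / 1

_^ℚ_ : ℚ → ℕ → ℚ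
q ^ℚ zero  = 1ℚ
q ^ℚ suc k = q * (q ^ℚ k)

-- A real number α with 0 ≤ α < 1, given by its (open) lower Dedekind
-- cut  Lower q  ⇔  q < α.

record Real01 : Set₁ where
  field
    Lower     : ℚ → Set
    downward  : ∀ {q r} → q ≤ r → Lower r → Lower q
    rounded   : ∀ {q} → Lower q → ∃[ r ] (q < r × Lower r)
    nonneg    : ∀ q → q < 0ℚ → Lower q
    belowOne  : ∃[ r ] (r < 1ℚ × ¬ Lower r)
open Real01 public

-- "e ≥ C · n^(1+α)", expressed through the rationals r = s/(suc t) with
-- 0 < r < 1 + α (n^(1+α) is the supremum of such n^r for n ≥ 1;
-- for n = 0 both sides are 0):   C^(t+1) · n^s ≤ e^(t+1).
AtLeastThreshold : Real01 → ℚ → ℕ → ℕ → Set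
AtLeastThreshold α C n e =
  (s t : ℕ) → 1 ℕ.≤ s → Lower α ((+ s / suc t) - 1ℚ) →
  (C ^ℚ suc t) * (ℕtoℚ n ^ℚ s) ≤ ℕtoℚ e ^ℚ suc t

record Graph (n : ℕ) : Set where
  field
    adj    : Fin n → Fin n → Bool
    sym    : ∀ i j → adj i j ≡ adj j i
    irrefl : ∀ i → adj i i ≡ false
open Graph public

pairs : (n : ℕ) → List (Fin n × Fin n)
pairs n = cartesianProduct (allFin n) (allFin n)

edges : ∀ {n} → Graph n → ℕ
edges {n} G = length (filterᵇ (λ p → adj G (proj₁ p) (proj₂ p) ∧ ⌊ toℕ (proj₁ p) ℕ.<? toℕ (proj₂ p) ⌋) (pairs n))

consF : ∀ {v n} → Fin n → (Fin v → Fin n) → Fin (suc v) → Fin n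
consF x f Fin.zero    = x
consF x f (Fin.suc i) = f i

allMaps : (v n : ℕ) → List (Fin v → Fin n)
allMaps zero    n = (λ ()) ∷ []
allMaps (suc v) n = concatMap (λ f → map (λ x → consF x f) (allFin n)) (allMaps v n)

allB : {A : Set} → (A → Bool) → List A → Bool
allB p []       = true
allB p (x ∷ xs) = p x ∧ allB p xs

isCopy : ∀ {v n} → Graph v → Graph n → (Fin v → Fin n) → Bool
isCopy {v} H G f = allB ok (pairs v)
  where
  ok : Fin v × Fin v → Bool
  ok (i , j) = (⌊ i Fin.≟ j ⌋ ∨' not ⌊ f i Fin.≟ f j ⌋) ∧ (not (adj H i j) ∨' adj G (f i) (f j))
    where
    _∨'_ : Bool → Bool → Bool
    true  ∨' _ = true
    false ∨' b = b

copies : ∀ {v n} → Graph v → Graph n → ℕ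
copies {v} {n} H G = length (filterᵇ (isCopy H G) (allMaps v n))

Bipartite : ∀ {v} → Graph v → Set
Bipartite {v} H = Σ (Fin v → Bool) (λ col → ∀ i j → adj H i j ≡ true → col i ≢ col j)

-- The p n² ≥ C n^(1+α) ⇒ ≥ β p^e(H) n^v(H) copies condition, with
-- e(G) = p n² substituted and multiplied out by n^(2 e(H)):
--   β · e(G)^e(H) · n^v(H) ≤ #copies · n^(2 e(H)).
ManyCopies : ℚ → ℕ → ℕ → ℕ → ℕ → ℕ → Set
ManyCopies β eH vH n eG cnt =
  β * (ℕtoℚ eG ^ℚ eH) * (ℕtoℚ n ^ℚ vH) ≤ ℕtoℚ cnt * (ℕtoℚ n ^ℚ (2 ℕ.* eH))

ESGoodWith : ∀ {v} → Real01 → ℚ → ℚ → Graph v → Set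
ESGoodWith {v} α C β H =
  ∀ n (G : Graph n) → AtLeastThreshold α C n (edges G) →
  ManyCopies β (edges H) v n (edges G) (copies H G)

ESGood : ∀ {v} → Real01 → Graph v → Set
ESGood α H = ∃[ C ] ∃[ β ] (0ℚ < C × 0ℚ < β × ESGoodWith α C β H)

record IsGluing {v₁ v₂ m : ℕ} (H₁ : Graph v₁) (H₂ : Graph v₂)
                (a₁ b₁ : Fin v₁) (a₂ b₂ : Fin v₂) (K : Graph m) : Set where
  field
    f₁ : Fin v₁ → Fin m
    f₂ : Fin v₂ → Fin m
    inj₁ : ∀ i j → f₁ i ≡ f₁ j → i ≡ j
    inj₂ : ∀ i j → f₂ i ≡ f₂ j → i ≡ j
    identify : (f₁ a₁ ≡ f₂ a₂ × f₁ b₁ ≡ f₂ b₂) ⊎ (f₁ a₁ ≡ f₂ b₂ × f₁ b₁ ≡ f₂ a₂)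
    meet : ∀ i j → f₁ i ≡ f₂ j → i ≡ a₁ ⊎ i ≡ b₁
    cover : ∀ x → (∃[ i ] f₁ i ≡ x) ⊎ (∃[ j ] f₂ j ≡ x)
    edgeSet : ∀ x y → (adj K x y ≡ true) ⇔
      ((∃[ i ] ∃[ j ] (f₁ i ≡ x × f₁ j ≡ y × adj H₁ i j ≡ true)) ⊎
       (∃[ i ] ∃[ j ] (f₂ i ≡ x × f₂ j ≡ y × adj H₂ i j ≡ true)))

{-# OPTIONS --safe #-}
module Submission where

-- Call an edge uv of G good if it carries at least a constant times the average number of disjoint
-- pairs (copy of H₁, copy of H₂) attached to it; such a pair spans a gluing. If few edges are good,
-- a positive proportion are not, and each of these either carries few copies of H₂ or has an attached
-- copy S(uv) of H₂ met by almost every copy of H₁ at uv. In the first case the subgraph of these edges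
-- contradicts the goodness of H₂. In the second, colour the vertices at random and keep the edges uv
-- whose ends are coloured while S(uv) minus uv is not: a constant proportion survives, and in the
-- surviving graph every copy of H₁ at uv avoids S(uv), so there are too few of them for H₁ to be good.

open import Defs hiding (sym)
import Data.Bool as Bool
open import Data.Bool using (Bool; true; false; _∧_; _∨_; not)
import Data.Bool.Properties as Boolₚ
open import Data.Empty using (⊥; ⊥-elim)
open import Data.Fin as Fin using (Fin; zero; suc; toℕ)
import Data.Fin.Properties as Finₚ
import Data.Integer as ℤ
import Data.Integer.Properties as ℤₚ
open import Data.List using (List; []; _∷_; _++_; map; concatMap; allFin; length; filterᵇ; cartesianProduct; tabulate)
open import Data.List.Membership.Propositional using (_∈_)
open import Data.List.Membership.Propositional.Properties using (∈-allFin; ∈-cartesianProduct⁺)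
open import Data.List.Relation.Unary.Any using (here; there)
open import Data.Nat using (ℕ; zero; suc; _+_; _*_; _∸_; _^_; _≤_; _<_; z≤n; s≤s; _<?_; _≤?_; s≤s⁻¹; NonZero; >-nonZero)
open import Data.Nat.Properties
open import Data.Nat.Tactic.RingSolver using (solve-∀)
open import Data.Product using (Σ; ∃-syntax; _×_; _,_; proj₁; proj₂)
open import Data.Rational as ℚ using (ℚ; mkℚ; 0ℚ; 1ℚ; toℚᵘ; Positive; NonNegative)
import Data.Rational.Properties as ℚₚ
import Data.Rational.Unnormalised as ℚᵘ
import Data.Rational.Unnormalised.Properties as ℚᵘₚ
open import Data.Sum using (_⊎_; inj₁; inj₂)
import Data.Vec.Functional as Vec
import Data.Vec.Functional.Properties as Vecₚ
open import Function using (_∘_; id; mk⇔)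
open import Relation.Binary.Definitions using (Tri; tri<; tri≈; tri>)
open import Relation.Binary.PropositionalEquality using (_≡_; _≢_; refl; sym; trans; cong; cong₂; subst; subst₂; module ≡-Reasoning)
open import Relation.Nullary using (¬_; ¬?; Dec; yes; no)
open import Relation.Nullary.Decidable using (⌊_⌋; _×-dec_; _⊎-dec_)
import Algebra.Properties.Semiring.Sum +-*-semiring as Sum

-- Finite sums

-- The difficulty is that `S(uv)` varies with the edge, while goodness of `H₁` counts copies in one
-- fixed graph and cannot see a condition attached to each edge. In the coloured graph the condition
-- "misses `S(uv)`" holds automatically for all its edges at once. The price is a constant factor in
-- edges and vertices that depends only on the size of `S(uv)`; the edge loss is prepaid by
-- enlarging `C`. Where `S(uv)` comes from: if the disjoint pairs at `uv` fall short of the average,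
-- then by pigeonhole some single copy of `H₂` at `uv` is disjoint from too few copies of `H₁`. The
-- first case of the overview is the second one with an empty set to avoid, so one lemma
-- (`robust-edge`) serves both graphs. It is applied to any quarter of the edges: if the two
-- exceptional classes each have less than a quarter, the edges outside both have at least a
-- quarter. Everything between the hypotheses and the conclusion is counted in natural numbers, with
-- `p` multiplied out.

⟦_⟧ : Bool → ℕ
⟦ true ⟧  = 1
⟦ false ⟧ = 0

⟦⟧≤1 : ∀ b → ⟦ b ⟧ ≤ 1
⟦⟧≤1 true  = ≤-refl
⟦⟧≤1 false = z≤n

⟦⟧-mono : ∀ {b c} → (b ≡ true → c ≡ true) → ⟦ b ⟧ ≤ ⟦ c ⟧
⟦⟧-mono {false} h = z≤n
⟦⟧-mono {true} {c} h rewrite h refl = ≤-refl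

⟦⟧-cong : ∀ {b c} → (b ≡ true → c ≡ true) → (c ≡ true → b ≡ true) → ⟦ b ⟧ ≡ ⟦ c ⟧
⟦⟧-cong h k = ≤-antisym (⟦⟧-mono h) (⟦⟧-mono k)

⟦∧⟧ : ∀ b c → ⟦ b ∧ c ⟧ ≡ ⟦ b ⟧ * ⟦ c ⟧
⟦∧⟧ true  c = sym (+-identityʳ _)
⟦∧⟧ false c = refl

⟦∨⟧≤ : ∀ b c → ⟦ b ∨ c ⟧ ≤ ⟦ b ⟧ + ⟦ c ⟧
⟦∨⟧≤ true  c = s≤s z≤n
⟦∨⟧≤ false c = ≤-refl

⟦⟧*-mono : ∀ b {x y} → (b ≡ true → x ≤ y) → ⟦ b ⟧ * x ≤ ⟦ b ⟧ * y
⟦⟧*-mono true  h = *-monoʳ-≤ 1 (h refl)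
⟦⟧*-mono false h = z≤n

⟦⟧*≤ : ∀ b x → ⟦ b ⟧ * x ≤ x
⟦⟧*≤ true  x = ≤-reflexive (*-identityˡ x)
⟦⟧*≤ false x = z≤n

∧-true : ∀ {b c} → b ∧ c ≡ true → b ≡ true × c ≡ true
∧-true {true} {true} _ = refl , refl

true-∧ : ∀ {b c} → b ≡ true → c ≡ true → b ∧ c ≡ true
true-∧ refl refl = refl

∨-true : ∀ {b c} → b ∨ c ≡ true → b ≡ true ⊎ c ≡ true
∨-true {true}         _ = inj₁ refl
∨-true {false} {true} _ = inj₂ refl

true-∨ˡ : ∀ {b c} → b ≡ true → b ∨ c ≡ true
true-∨ˡ refl = refl

true-∨ʳ : ∀ {b c} → c ≡ true → b ∨ c ≡ true
true-∨ʳ {true}  _ = refl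
true-∨ʳ {false} h = h

true≢false : ∀ {b} → b ≡ true → b ≡ false → ⊥
true≢false refl ()

true-not : ∀ {b} → not b ≡ true → b ≡ false
true-not {false} _ = refl

⌊⌋-true : ∀ {P : Set} (d : Dec P) → P → ⌊ d ⌋ ≡ true
⌊⌋-true (yes _) p = refl
⌊⌋-true (no ¬p) p = ⊥-elim (¬p p)

true-⌊⌋ : ∀ {P : Set} (d : Dec P) → ⌊ d ⌋ ≡ true → P
true-⌊⌋ (yes p) _ = p

-- Abstract because unification cannot invert the fold behind the library's sum.
abstract
  sum : ∀ {n} → (Fin n → ℕ) → ℕ
  sum = Sum.sum

  sum-zero : {f : Fin 0 → ℕ} → sum f ≡ 0
  sum-zero = refl

  sum-suc : ∀ {n} (f : Fin (suc n) → ℕ) → sum f ≡ f zero + sum (f ∘ suc)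
  sum-suc f = refl

  sum-cong-≗ : ∀ {n} {f g : Fin n → ℕ} → (∀ i → f i ≡ g i) → sum f ≡ sum g
  sum-cong-≗ = Sum.sum-cong-≗

  ∑-distrib-+ : ∀ {n} (f g : Fin n → ℕ) → sum (λ i → f i + g i) ≡ sum f + sum g
  ∑-distrib-+ = Sum.∑-distrib-+

  ∑-comm : ∀ {m n} (f : Fin m → Fin n → ℕ) → sum (λ i → sum (f i)) ≡ sum (λ j → sum (λ i → f i j))
  ∑-comm = Sum.∑-comm

  *-distribˡ-sum : ∀ {n} c (f : Fin n → ℕ) → c * sum f ≡ sum (λ i → c * f i)
  *-distribˡ-sum = Sum.*-distribˡ-sum

  *-distribʳ-sum : ∀ {n} c (f : Fin n → ℕ) → sum f * c ≡ sum (λ i → f i * c)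
  *-distribʳ-sum = Sum.*-distribʳ-sum

  sum-mono : ∀ {n} {f g : Fin n → ℕ} → (∀ i → f i ≤ g i) → sum f ≤ sum g
  sum-mono {zero}  h = z≤n
  sum-mono {suc n} h = +-mono-≤ (h zero) (sum-mono (h ∘ suc))

  sum-const : ∀ n c → sum {n} (λ _ → c) ≡ n * c
  sum-const zero    c = refl
  sum-const (suc n) c = cong (c +_) (sum-const n c)

  term≤sum : ∀ {n} (f : Fin n → ℕ) i → f i ≤ sum f
  term≤sum f zero    = m≤m+n _ _
  term≤sum f (suc i) = ≤-trans (term≤sum (f ∘ suc) i) (m≤n+m _ _)

  sum-exists-< : ∀ {n} {f g : Fin n → ℕ} → sum f < sum g → ∃[ i ] f i < g i
  sum-exists-< {suc n} {f} {g} lt with f zero <? g zero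
  ... | yes p = zero , p
  ... | no ¬p with sum (f ∘ suc) <? sum (g ∘ suc)
  ... | yes q = let i , r = sum-exists-< q in suc i , r
  ... | no ¬q = ⊥-elim (<⇒≱ lt (+-mono-≤ (≮⇒≥ ¬p) (≮⇒≥ ¬q)))

  sum-δ : ∀ {n} (u : Fin n) → sum (λ i → ⟦ ⌊ u Fin.≟ i ⌋ ⟧) ≡ 1
  sum-δ {suc n} zero    = cong suc (trans (sum-const n 0) (*-zeroʳ n))
  sum-δ {suc n} (suc u) = trans (sum-cong-≗ step) (sum-δ u)
    where
    step : ∀ i → ⟦ ⌊ suc u Fin.≟ suc i ⌋ ⟧ ≡ ⟦ ⌊ u Fin.≟ i ⌋ ⟧
    step i with u Fin.≟ i
    ... | yes _ = refl
    ... | no _  = refl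

sum₂ : ∀ {n} → (Fin n → Fin n → ℕ) → ℕ
sum₂ f = sum (λ u → sum (λ v → f u v))

sum₂-mono : ∀ {n} {f g : Fin n → Fin n → ℕ} → (∀ u v → f u v ≤ g u v) → sum₂ f ≤ sum₂ g
sum₂-mono h = sum-mono (λ u → sum-mono (h u))

sum₂-cong : ∀ {n} {f g : Fin n → Fin n → ℕ} → (∀ u v → f u v ≡ g u v) → sum₂ f ≡ sum₂ g
sum₂-cong h = sum-cong-≗ (λ u → sum-cong-≗ (h u))

sum₂-distrib-+ : ∀ {n} (f g : Fin n → Fin n → ℕ) → sum₂ (λ u v → f u v + g u v) ≡ sum₂ f + sum₂ g
sum₂-distrib-+ f g = trans (sum-cong-≗ (λ u → ∑-distrib-+ (f u) (g u))) (∑-distrib-+ (λ u → sum (f u)) (λ u → sum (g u)))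

sum₂-*ˡ : ∀ {n} c (f : Fin n → Fin n → ℕ) → sum₂ (λ u v → c * f u v) ≡ c * sum₂ f
sum₂-*ˡ c f = trans (sum-cong-≗ (λ u → sym (*-distribˡ-sum c (f u)))) (sym (*-distribˡ-sum c (λ u → sum (f u))))

sum₂-*ʳ : ∀ {n} c (f : Fin n → Fin n → ℕ) → sum₂ (λ u v → f u v * c) ≡ sum₂ f * c
sum₂-*ʳ c f = trans (sum-cong-≗ (λ u → sym (*-distribʳ-sum c (f u)))) (sym (*-distribʳ-sum c (λ u → sum (f u))))

sum₂-exists-< : ∀ {n} {f g : Fin n → Fin n → ℕ} → sum₂ f < sum₂ g → ∃[ u ] ∃[ v ] f u v < g u v
sum₂-exists-< lt = let u , r = sum-exists-< lt in u , sum-exists-< r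

-- Ordered and unordered pairs of vertices

infix 7 _<ᵇᶠ_
_<ᵇᶠ_ : ∀ {n} → Fin n → Fin n → Bool
u <ᵇᶠ v = ⌊ toℕ u <? toℕ v ⌋

unordered-sum : ∀ {n} (q : Fin n → Fin n → ℕ) →
  sum₂ (λ u v → ⟦ u <ᵇᶠ v ⟧ * (q u v + q v u)) ≡ sum₂ (λ u v → (⟦ u <ᵇᶠ v ⟧ + ⟦ v <ᵇᶠ u ⟧) * q u v)
unordered-sum q = begin
  sum₂ (λ u v → ⟦ u <ᵇᶠ v ⟧ * (q u v + q v u))
    ≡⟨ sum₂-cong (λ u v → *-distribˡ-+ ⟦ u <ᵇᶠ v ⟧ (q u v) (q v u)) ⟩
  sum₂ (λ u v → ⟦ u <ᵇᶠ v ⟧ * q u v + ⟦ u <ᵇᶠ v ⟧ * q v u)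
    ≡⟨ sum₂-distrib-+ (λ u v → ⟦ u <ᵇᶠ v ⟧ * q u v) (λ u v → ⟦ u <ᵇᶠ v ⟧ * q v u) ⟩
  sum₂ (λ u v → ⟦ u <ᵇᶠ v ⟧ * q u v) + sum₂ (λ u v → ⟦ u <ᵇᶠ v ⟧ * q v u)
    ≡⟨ cong (sum₂ (λ u v → ⟦ u <ᵇᶠ v ⟧ * q u v) +_) (∑-comm (λ u v → ⟦ u <ᵇᶠ v ⟧ * q v u)) ⟩
  sum₂ (λ u v → ⟦ u <ᵇᶠ v ⟧ * q u v) + sum₂ (λ u v → ⟦ v <ᵇᶠ u ⟧ * q u v)
    ≡⟨ sum₂-distrib-+ (λ u v → ⟦ u <ᵇᶠ v ⟧ * q u v) (λ u v → ⟦ v <ᵇᶠ u ⟧ * q u v) ⟨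
  sum₂ (λ u v → ⟦ u <ᵇᶠ v ⟧ * q u v + ⟦ v <ᵇᶠ u ⟧ * q u v)
    ≡⟨ sum₂-cong (λ u v → *-distribʳ-+ (q u v) ⟦ u <ᵇᶠ v ⟧ ⟦ v <ᵇᶠ u ⟧) ⟨
  sum₂ (λ u v → (⟦ u <ᵇᶠ v ⟧ + ⟦ v <ᵇᶠ u ⟧) * q u v) ∎
  where open ≡-Reasoning

-- At most one of `u < v` and `v < u` holds. This bound and its converse below mediate between
-- `edges`, which sees a pair once, and sums over maps, which see both orders.
unordered-sum-≤ : ∀ {n} (q : Fin n → Fin n → ℕ) → sum₂ (λ u v → ⟦ u <ᵇᶠ v ⟧ * (q u v + q v u)) ≤ sum₂ q
unordered-sum-≤ q = ≤-trans (≤-reflexive (unordered-sum q)) (sum₂-mono step)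
  where
  step : ∀ u v → (⟦ u <ᵇᶠ v ⟧ + ⟦ v <ᵇᶠ u ⟧) * q u v ≤ q u v
  step u v with toℕ u <? toℕ v | toℕ v <? toℕ u
  ... | yes p | yes p' = ⊥-elim (<-asym p p')
  ... | yes _ | no _   = ≤-reflexive (*-identityˡ _)
  ... | no _  | yes _  = ≤-reflexive (*-identityˡ _)
  ... | no _  | no _   = z≤n

≤-unordered-sum : ∀ {n} (q : Fin n → Fin n → ℕ) → (∀ u → q u u ≡ 0) →
  sum₂ q ≤ sum₂ (λ u v → ⟦ u <ᵇᶠ v ⟧ * (q u v + q v u))
≤-unordered-sum q diag = ≤-trans (sum₂-mono step) (≤-reflexive (sym (unordered-sum q)))
  where
  step : ∀ u v → q u v ≤ (⟦ u <ᵇᶠ v ⟧ + ⟦ v <ᵇᶠ u ⟧) * q u v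
  step u v with toℕ u <? toℕ v | toℕ v <? toℕ u
  ... | yes p | yes p' = ⊥-elim (<-asym p p')
  ... | yes _ | no _   = ≤-reflexive (sym (*-identityˡ _))
  ... | no _  | yes _  = ≤-reflexive (sym (*-identityˡ _))
  ... | no ¬p | no ¬p' rewrite Finₚ.toℕ-injective (≤-antisym (≮⇒≥ ¬p') (≮⇒≥ ¬p)) = ≤-reflexive (diag v)

heavy-pair : ∀ {n} (e : Fin n → Fin n → Bool) (x : ℕ) (y : Fin n → Fin n → ℕ) →
  0 < sum₂ (λ u v → ⟦ e u v ⟧) →
  sum₂ (λ u v → ⟦ e u v ⟧) * x ≤ sum₂ (λ u v → ⟦ e u v ⟧ * y u v) →
  ∃[ u ] ∃[ v ] (e u v ≡ true × x ≤ y u v)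
heavy-pair e x y pos le = let u , v , r = sum₂-exists-< lt in u , v , extract (e u v) r
  where
  -- The extra `⟦ e u v ⟧` makes the comparison strict, and it does so only on pairs satisfying `e`:
  -- elsewhere both sides are 0. On the pair found, `x < 1 + y` is `x ≤ y`.
  lt : sum₂ (λ u v → ⟦ e u v ⟧ * x) < sum₂ (λ u v → ⟦ e u v ⟧ + ⟦ e u v ⟧ * y u v)
  lt = begin-strict
    sum₂ (λ u v → ⟦ e u v ⟧ * x)  ≡⟨ sum₂-*ʳ x (λ u v → ⟦ e u v ⟧) ⟩
    sum₂ (λ u v → ⟦ e u v ⟧) * x  ≤⟨ le ⟩
    sum₂ (λ u v → ⟦ e u v ⟧ * y u v)  <⟨ +-monoˡ-< _ pos ⟩
    sum₂ (λ u v → ⟦ e u v ⟧) + sum₂ (λ u v → ⟦ e u v ⟧ * y u v)  ≡⟨ sum₂-distrib-+ (λ u v → ⟦ e u v ⟧) (λ u v → ⟦ e u v ⟧ * y u v) ⟨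
    sum₂ (λ u v → ⟦ e u v ⟧ + ⟦ e u v ⟧ * y u v) ∎
    where open ≤-Reasoning
  extract : ∀ b {y} → ⟦ b ⟧ * x < ⟦ b ⟧ + ⟦ b ⟧ * y → b ≡ true × x ≤ y
  extract true {y} lt rewrite *-identityˡ x | *-identityˡ y = refl , s≤s⁻¹ lt

-- Sums over all maps between finite sets

∑M : ∀ v {n} → ((Fin v → Fin n) → ℕ) → ℕ
∑M zero    F = F (λ ())
∑M (suc v) F = ∑M v (λ f → sum (λ x → F (consF x f)))

∑M-cong : ∀ v {n} {F G : (Fin v → Fin n) → ℕ} → (∀ f → F f ≡ G f) → ∑M v F ≡ ∑M v G
∑M-cong zero    h = h _
∑M-cong (suc v) h = ∑M-cong v (λ f → sum-cong-≗ (λ x → h (consF x f)))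

∑M-mono : ∀ v {n} {F G : (Fin v → Fin n) → ℕ} → (∀ f → F f ≤ G f) → ∑M v F ≤ ∑M v G
∑M-mono zero    h = h _
∑M-mono (suc v) h = ∑M-mono v (λ f → sum-mono (λ x → h (consF x f)))

∑M-distrib-+ : ∀ v {n} (F G : (Fin v → Fin n) → ℕ) → ∑M v (λ f → F f + G f) ≡ ∑M v F + ∑M v G
∑M-distrib-+ zero    F G = refl
∑M-distrib-+ (suc v) F G = trans (∑M-cong v (λ f → ∑-distrib-+ _ _)) (∑M-distrib-+ v _ _)

∑M-*ˡ : ∀ v {n} c (F : (Fin v → Fin n) → ℕ) → ∑M v (λ f → c * F f) ≡ c * ∑M v F
∑M-*ˡ zero    c F = refl
∑M-*ˡ (suc v) c F = trans (∑M-cong v (λ f → sym (*-distribˡ-sum c _))) (∑M-*ˡ v c _)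

∑M-*ʳ : ∀ v {n} c (F : (Fin v → Fin n) → ℕ) → ∑M v (λ f → F f * c) ≡ ∑M v F * c
∑M-*ʳ v c F = trans (∑M-cong v (λ f → *-comm (F f) c)) (trans (∑M-*ˡ v c F) (*-comm c _))

∑M-sum-comm : ∀ v {n k} (F : (Fin v → Fin n) → Fin k → ℕ) →
  ∑M v (λ f → sum (F f)) ≡ sum (λ i → ∑M v (λ f → F f i))
∑M-sum-comm zero    F = refl
∑M-sum-comm (suc v) F = trans (∑M-cong v (λ f → ∑-comm (λ x i → F (consF x f) i))) (∑M-sum-comm v _)

∑M-sum₂-comm : ∀ v {n k} (F : (Fin v → Fin n) → Fin k → Fin k → ℕ) →
  ∑M v (λ f → sum₂ (F f)) ≡ sum₂ (λ i j → ∑M v (λ f → F f i j))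
∑M-sum₂-comm v F = trans (∑M-sum-comm v _) (sum-cong-≗ (λ i → ∑M-sum-comm v (λ f → F f i)))

∑M-exists-< : ∀ v {n} {F G : (Fin v → Fin n) → ℕ} → ∑M v F < ∑M v G → ∃[ f ] F f < G f
∑M-exists-< zero    lt = (λ ()) , lt
∑M-exists-< (suc v) lt =
  let f , r = ∑M-exists-< v lt ; x , q = sum-exists-< r in consF x f , q

-- Regrouping the coordinates of a map yields a map that is only pointwise equal to the original, so
-- the summand has to respect pointwise equality.
Extensional : ∀ {v n} → ((Fin v → Fin n) → ℕ) → Set
Extensional F = ∀ {f g} → (∀ i → f i ≡ g i) → F f ≡ F g

consF-cong : ∀ {v n} (x : Fin n) {f g : Fin v → Fin n} → (∀ i → f i ≡ g i) → ∀ i → consF x f i ≡ consF x g i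
consF-cong x h zero    = refl
consF-cong x h (suc i) = h i

-- Moves the coordinate `a` into the innermost sum by exchanging sums along the way. Two uses
-- isolate the images of the two ends of an edge.
∑M-insertAt : ∀ {v n} (a : Fin (suc v)) (F : (Fin (suc v) → Fin n) → ℕ) → Extensional F →
  ∑M (suc v) F ≡ ∑M v (λ g → sum (λ x → F (Vec.insertAt g a x)))
∑M-insertAt {v} zero F ext = ∑M-cong v (λ g → sum-cong-≗ (λ x → ext (λ { zero → refl ; (suc i) → refl })))
∑M-insertAt {suc v} {n} (suc a) F ext = begin
  ∑M (suc v) (λ f → sum (λ y → F (consF y f)))
    ≡⟨ ∑M-insertAt a _ (λ h → sum-cong-≗ (λ y → ext (consF-cong y h))) ⟩
  ∑M v (λ g → sum (λ x → sum (λ y → F (consF y (Vec.insertAt g a x)))))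
    ≡⟨ ∑M-cong v (λ g → ∑-comm (λ x y → F (consF y (Vec.insertAt g a x)))) ⟩
  ∑M v (λ g → sum (λ y → sum (λ x → F (consF y (Vec.insertAt g a x)))))
    ≡⟨ ∑M-cong v (λ g → sum-cong-≗ (λ y → sum-cong-≗ (λ x → ext (λ { zero → refl ; (suc i) → refl })))) ⟩
  ∑M v (λ g → sum (λ y → sum (λ x → F (Vec.insertAt (consF y g) (suc a) x)))) ∎
  where open ≡-Reasoning

∑M-++ : ∀ v w {n} (F : (Fin (v + w) → Fin n) → ℕ) → Extensional F →
  ∑M (v + w) F ≡ ∑M w (λ g → ∑M v (λ f → F (f Vec.++ g)))
∑M-++ zero    w F ext = refl
∑M-++ (suc v) w F ext = trans (∑M-++ v w _ (λ h → sum-cong-≗ (λ x → ext (consF-cong x h))))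
  (∑M-cong w (λ g → ∑M-cong v (λ f → sum-cong-≗ (λ x → ext (consF-++ x f g)))))
  where
  consF-++ : ∀ x f g i → consF x (f Vec.++ g) i ≡ (consF x f Vec.++ g) i
  consF-++ x f g zero = refl
  consF-++ x f g (suc i) with Fin.splitAt v i
  ... | inj₁ _ = refl
  ... | inj₂ _ = refl

-- The maps that land in the image of `ι` are only some of all maps. The hypothesis on sums stands
-- for injectivity of `ι`; it is what an `Enumeration` supplies.
∑M-inject : ∀ w {k n} (ι : Fin k → Fin n) → (∀ F → sum (F ∘ ι) ≤ sum F) →
  (F : (Fin w → Fin n) → ℕ) → Extensional F → ∑M w (λ g → F (ι ∘ g)) ≤ ∑M w F
∑M-inject zero    ι le F ext = ≤-reflexive (ext (λ ()))
∑M-inject (suc w) ι le F ext = begin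
  ∑M w (λ g → sum (λ x → F (ι ∘ consF x g)))
    ≡⟨ ∑M-cong w (λ g → sum-cong-≗ (λ x → ext (λ { zero → refl ; (suc i) → refl }))) ⟩
  ∑M w (λ g → sum (λ x → F (consF (ι x) (ι ∘ g))))
    ≤⟨ ∑M-mono w (λ g → le (λ x → F (consF x (ι ∘ g)))) ⟩
  ∑M w (λ g → sum (λ x → F (consF x (ι ∘ g))))
    ≤⟨ ∑M-inject w ι le _ (λ h → sum-cong-≗ (λ x → ext (consF-cong x h))) ⟩
  ∑M w (λ g → sum (λ x → F (consF x g))) ∎
  where open ≤-Reasoning

-- Counts over lists as finite sums

sumL : {A : Set} → (A → ℕ) → List A → ℕ
sumL F []       = 0
sumL F (x ∷ xs) = F x + sumL F xs

sumL-++ : {A : Set} (F : A → ℕ) (xs ys : List A) → sumL F (xs ++ ys) ≡ sumL F xs + sumL F ys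
sumL-++ F []       ys = refl
sumL-++ F (x ∷ xs) ys = trans (cong (F x +_) (sumL-++ F xs ys)) (sym (+-assoc (F x) _ _))

sumL-map : {A B : Set} (F : B → ℕ) (g : A → B) (xs : List A) → sumL F (map g xs) ≡ sumL (F ∘ g) xs
sumL-map F g []       = refl
sumL-map F g (x ∷ xs) = cong (F (g x) +_) (sumL-map F g xs)

sumL-cong : {A : Set} {F G : A → ℕ} → (∀ x → F x ≡ G x) → (xs : List A) → sumL F xs ≡ sumL G xs
sumL-cong h []       = refl
sumL-cong h (x ∷ xs) = cong₂ _+_ (h x) (sumL-cong h xs)

sumL-concatMap : {A B : Set} (F : B → ℕ) (k : A → List B) (xs : List A) →
  sumL F (concatMap k xs) ≡ sumL (λ x → sumL F (k x)) xs
sumL-concatMap F k []       = refl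
sumL-concatMap F k (x ∷ xs) = trans (sumL-++ F (k x) _) (cong (sumL F (k x) +_) (sumL-concatMap F k xs))

sumL-cartesianProduct : {A B : Set} (F : A × B → ℕ) (xs : List A) (ys : List B) →
  sumL F (cartesianProduct xs ys) ≡ sumL (λ x → sumL (λ y → F (x , y)) ys) xs
sumL-cartesianProduct F []       ys = refl
sumL-cartesianProduct F (x ∷ xs) ys =
  trans (sumL-++ F (map (x ,_) ys) _) (cong₂ _+_ (sumL-map F (x ,_) ys) (sumL-cartesianProduct F xs ys))

sumL-tabulate : ∀ {A : Set} {n} (F : A → ℕ) (g : Fin n → A) → sumL F (tabulate g) ≡ sum (F ∘ g)
sumL-tabulate {n = zero}  F g = sym sum-zero
sumL-tabulate {n = suc n} F g = trans (cong (F (g zero) +_) (sumL-tabulate F (g ∘ suc))) (sym (sum-suc (F ∘ g)))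

length-filterᵇ : {A : Set} (p : A → Bool) (xs : List A) → length (filterᵇ p xs) ≡ sumL (λ x → ⟦ p x ⟧) xs
length-filterᵇ p []       = refl
length-filterᵇ p (x ∷ xs) with p x
... | true  = cong suc (length-filterᵇ p xs)
... | false = length-filterᵇ p xs

sumL-allMaps : ∀ v n (F : (Fin v → Fin n) → ℕ) → sumL F (allMaps v n) ≡ ∑M v F
sumL-allMaps zero    n F = +-identityʳ _
sumL-allMaps (suc v) n F = begin
  sumL F (concatMap (λ f → map (λ x → consF x f) (allFin n)) (allMaps v n))
    ≡⟨ sumL-concatMap F _ (allMaps v n) ⟩
  sumL (λ f → sumL F (map (λ x → consF x f) (allFin n))) (allMaps v n)
    ≡⟨ sumL-cong (λ f → trans (sumL-map F _ (allFin n)) (sumL-tabulate _ id)) (allMaps v n) ⟩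
  sumL (λ f → sum (λ x → F (consF x f))) (allMaps v n)
    ≡⟨ sumL-allMaps v n _ ⟩
  ∑M v (λ f → sum (λ x → F (consF x f))) ∎
  where open ≡-Reasoning

copies≡∑M : ∀ {v n} (H : Graph v) (G : Graph n) → copies H G ≡ ∑M v (λ f → ⟦ isCopy H G f ⟧)
copies≡∑M {v} {n} H G = trans (length-filterᵇ (isCopy H G) (allMaps v n)) (sumL-allMaps v n (λ f → ⟦ isCopy H G f ⟧))

edges≡sum₂ : ∀ {n} (G : Graph n) → edges G ≡ sum₂ (λ u v → ⟦ adj G u v ∧ u <ᵇᶠ v ⟧)
edges≡sum₂ {n} G = begin
  edges G  ≡⟨ length-filterᵇ e (pairs n) ⟩
  sumL F (pairs n)  ≡⟨ sumL-cartesianProduct F (allFin n) (allFin n) ⟩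
  sumL (λ u → sumL (λ v → F (u , v)) (allFin n)) (allFin n)  ≡⟨ sumL-tabulate _ id ⟩
  sum (λ u → sumL (λ v → F (u , v)) (allFin n))  ≡⟨ sum-cong-≗ (λ u → sumL-tabulate (λ v → F (u , v)) id) ⟩
  sum₂ (λ u v → ⟦ adj G u v ∧ u <ᵇᶠ v ⟧) ∎
  where
  open ≡-Reasoning
  e : Fin n × Fin n → Bool
  e (u , v) = adj G u v ∧ u <ᵇᶠ v
  F : Fin n × Fin n → ℕ
  F p = ⟦ e p ⟧

-- Copies and rooted graphs

allB-sound : {A : Set} (p : A → Bool) (xs : List A) → allB p xs ≡ true → ∀ {x} → x ∈ xs → p x ≡ true
allB-sound p (x ∷ xs) h (here refl) = proj₁ (∧-true h)
allB-sound p (x ∷ xs) h (there i)   = allB-sound p xs (proj₂ (∧-true h)) i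

allB-complete : {A : Set} (p : A → Bool) (xs : List A) → (∀ x → p x ≡ true) → allB p xs ≡ true
allB-complete p []       h = refl
allB-complete p (x ∷ xs) h = true-∧ (h x) (allB-complete p xs h)

IsCopy : ∀ {v n} → Graph v → Graph n → (Fin v → Fin n) → Set
IsCopy H G f = (∀ i j → f i ≡ f j → i ≡ j) × (∀ i j → adj H i j ≡ true → adj G (f i) (f j) ≡ true)

isCopy-sound : ∀ {v n} (H : Graph v) (G : Graph n) (f : Fin v → Fin n) → isCopy H G f ≡ true → IsCopy H G f
isCopy-sound {v} H G f h = inj , hom
  where
  ok = λ i j → allB-sound _ (pairs v) h (∈-cartesianProduct⁺ (∈-allFin i) (∈-allFin j))
  inj : ∀ i j → f i ≡ f j → i ≡ j
  inj i j e with ok i j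
  ... | p with i Fin.≟ j | f i Fin.≟ f j
  ... | yes q | _      = q
  ... | no _  | no ¬r  = ⊥-elim (¬r e)
  hom : ∀ i j → adj H i j ≡ true → adj G (f i) (f j) ≡ true
  hom i j e with ok i j
  ... | p with i Fin.≟ j | f i Fin.≟ f j
  hom i j e | p | yes _ | _ rewrite e = p
  hom i j e | p | no _ | no _ rewrite e = p

isCopy-complete : ∀ {v n} (H : Graph v) (G : Graph n) (f : Fin v → Fin n) → IsCopy H G f → isCopy H G f ≡ true
isCopy-complete {v} H G f (inj , hom) = allB-complete _ (pairs v) ok
  where
  ok : ∀ x → _
  ok (i , j) with i Fin.≟ j | f i Fin.≟ f j | adj H i j in e
  ... | yes _ | _     | false = refl
  ... | yes _ | _     | true  = hom i j e
  ... | no q  | yes r | _     = ⊥-elim (q (inj i j r))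
  ... | no _  | no _  | false = refl
  ... | no _  | no _  | true  = hom i j e

isCopy-ext : ∀ {v n} (H : Graph v) (G : Graph n) → Extensional (λ f → ⟦ isCopy H G f ⟧)
isCopy-ext H G {f} {g} h = ⟦⟧-cong (step f g h) (step g f (λ i → sym (h i)))
  where
  step : ∀ f g → (∀ i → f i ≡ g i) → isCopy H G f ≡ true → isCopy H G g ≡ true
  step f g h c with isCopy-sound H G f c
  ... | inj , hom = isCopy-complete H G g
    ( (λ i j e → inj i j (trans (h i) (trans e (sym (h j)))))
    , (λ i j e → subst (λ x → adj G x (g j) ≡ true) (h i)
                   (subst (λ y → adj G (f i) y ≡ true) (h j) (hom i j e))))

-- Graphs rooted at an edge

data Slot (w : ℕ) : Set where
  left right : Slot w
  free       : Fin w → Slot w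

fill : ∀ {A : Set} {w} → A → A → (Fin w → A) → Slot w → A
fill x y g left     = x
fill x y g right    = y
fill x y g (free j) = g j

orient : ∀ {A B : Set} → Bool → (A → A → B) → A → A → B
orient false k x y = k x y
orient true  k x y = k y x

-- Coordinates on the vertices in which `a` and `b` stand apart from the `rest` others. Through
-- `decompose`, a sum over all maps becomes a sum over the images of `a` and `b` and, independently,
-- of the other vertices; this is what lets copies be counted edge by edge.
record Rooting {v : ℕ} (a b : Fin v) : Set where
  field
    rest          : ℕ
    slot          : Fin v → Slot rest
    unslot        : Slot rest → Fin v
    slot-unslot   : ∀ s → slot (unslot s) ≡ s
    unslot-slot   : ∀ i → unslot (slot i) ≡ i
    unslot-left   : unslot left ≡ a
    unslot-right  : unslot right ≡ b
    size          : v ≡ 2 + rest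
    decompose     : ∀ {n} (F : (Fin v → Fin n) → ℕ) → Extensional F →
                    ∑M v F ≡ ∑M rest (λ g → sum₂ (λ x y → F (λ i → fill x y g (slot i))))

  place : ∀ {A : Set} → Bool → A → A → (Fin rest → A) → Fin v → A
  place o x y g i = orient o (λ x y → fill x y g (slot i)) x y

rooting : ∀ {v} {a b : Fin v} → a ≢ b → Rooting a b
rooting {suc zero} {zero} {zero} a≢b = ⊥-elim (a≢b refl)
rooting {suc (suc w)} {a} {b} a≢b = record
  { rest = w ; slot = slot ; unslot = unslot
  ; slot-unslot = slot-unslot ; unslot-slot = unslot-slot
  ; unslot-left = refl ; unslot-right = Finₚ.punchIn-punchOut a≢b ; size = refl
  ; decompose = decompose }
  where
  b' : Fin (suc w)
  b' = Fin.punchOut a≢b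

  unslot : Slot w → Fin (suc (suc w))
  unslot left     = a
  unslot right    = Fin.punchIn a b'
  unslot (free j) = Fin.punchIn a (Fin.punchIn b' j)

  slot' : Fin (suc w) → Slot w
  slot' k with b' Fin.≟ k
  ... | yes _ = right
  ... | no p  = free (Fin.punchOut p)

  slot : Fin (suc (suc w)) → Slot w
  slot i with a Fin.≟ i
  ... | yes _ = left
  ... | no p  = slot' (Fin.punchOut p)

  unslot-slot' : ∀ k → unslot (slot' k) ≡ Fin.punchIn a k
  unslot-slot' k with b' Fin.≟ k
  ... | yes refl = refl
  ... | no p     = cong (Fin.punchIn a) (Finₚ.punchIn-punchOut p)

  unslot-slot : ∀ i → unslot (slot i) ≡ i
  unslot-slot i with a Fin.≟ i
  ... | yes refl = refl
  ... | no p     = trans (unslot-slot' _) (Finₚ.punchIn-punchOut p)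

  unslot-injective : ∀ s t → unslot s ≡ unslot t → s ≡ t
  unslot-injective left     left     e = refl
  unslot-injective left     right    e = ⊥-elim (Finₚ.punchInᵢ≢i a _ (sym e))
  unslot-injective left     (free j) e = ⊥-elim (Finₚ.punchInᵢ≢i a _ (sym e))
  unslot-injective right    left     e = ⊥-elim (Finₚ.punchInᵢ≢i a _ e)
  unslot-injective right    right    e = refl
  unslot-injective right    (free j) e = ⊥-elim (Finₚ.punchInᵢ≢i b' j (sym (Finₚ.punchIn-injective a _ _ e)))
  unslot-injective (free j) left     e = ⊥-elim (Finₚ.punchInᵢ≢i a _ e)
  unslot-injective (free j) right    e = ⊥-elim (Finₚ.punchInᵢ≢i b' j (Finₚ.punchIn-injective a _ _ e))
  unslot-injective (free j) (free k) e =
    cong free (Finₚ.punchIn-injective b' _ _ (Finₚ.punchIn-injective a _ _ e))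

  -- A one-sided inverse of an injective map is two-sided.
  slot-unslot : ∀ s → slot (unslot s) ≡ s
  slot-unslot s = unslot-injective _ _ (unslot-slot (unslot s))

  insertAt² : ∀ {n} (x y : Fin n) g s → Vec.insertAt (Vec.insertAt g b' y) a x (unslot s) ≡ fill x y g s
  insertAt² x y g left     = Vecₚ.insertAt-lookup _ a x
  insertAt² x y g right    = trans (Vecₚ.insertAt-punchIn _ a x b') (Vecₚ.insertAt-lookup g b' y)
  insertAt² x y g (free j) = trans (Vecₚ.insertAt-punchIn _ a x _) (Vecₚ.insertAt-punchIn g b' y j)

  decompose : ∀ {n} (F : (Fin (suc (suc w)) → Fin n) → ℕ) → Extensional F →
    ∑M (suc (suc w)) F ≡ ∑M w (λ g → sum₂ (λ x y → F (λ i → fill x y g (slot i))))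
  decompose F ext = begin
    ∑M (suc (suc w)) F
      ≡⟨ ∑M-insertAt a F ext ⟩
    ∑M (suc w) (λ h → sum (λ x → F (Vec.insertAt h a x)))
      ≡⟨ ∑M-insertAt b' _ (λ h → sum-cong-≗ (λ x → ext (insertAt-cong a x h))) ⟩
    ∑M w (λ g → sum (λ y → sum (λ x → F (Vec.insertAt (Vec.insertAt g b' y) a x))))
      ≡⟨ ∑M-cong w (λ g → ∑-comm (λ y x → F (Vec.insertAt (Vec.insertAt g b' y) a x))) ⟩
    ∑M w (λ g → sum₂ (λ x y → F (Vec.insertAt (Vec.insertAt g b' y) a x)))
      ≡⟨ ∑M-cong w (λ g → sum₂-cong (λ x y → ext (λ i →
           trans (cong (Vec.insertAt (Vec.insertAt g b' y) a x) (sym (unslot-slot i))) (insertAt² x y g (slot i))))) ⟩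
    ∑M w (λ g → sum₂ (λ x y → F (λ i → fill x y g (slot i)))) ∎
    where
    open ≡-Reasoning
    insertAt-cong : ∀ {v n} (a : Fin (suc v)) (x : Fin n) {f g : Fin v → Fin n} → (∀ i → f i ≡ g i) →
      ∀ i → Vec.insertAt f a x i ≡ Vec.insertAt g a x i
    insertAt-cong zero            x h zero    = refl
    insertAt-cong zero            x h (suc i) = h i
    insertAt-cong {suc v} (suc a) x h zero    = h zero
    insertAt-cong {suc v} (suc a) x h (suc i) = insertAt-cong a x (h ∘ suc) i

-- Random colourings

-- Goodness speaks of graphs on `Fin n`, so the chosen vertices have to be renumbered. The numbering
-- is increasing because `edges` counts pairs `u < v`.
record Enumeration {n : ℕ} (p : Fin n → Bool) : Set where
  field
    count      : ℕ
    member     : Fin count → Fin n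
    member-in  : ∀ i → p (member i) ≡ true
    monotone   : ∀ {i j} → toℕ i < toℕ j → toℕ (member i) < toℕ (member j)
    sum-member : ∀ F → sum (F ∘ member) ≡ sum (λ z → ⟦ p z ⟧ * F z)

  member-injective : ∀ i j → member i ≡ member j → i ≡ j
  member-injective i j e = Finₚ.toℕ-injective
    (≤-antisym (≮⇒≥ (λ lt → <-irrefl (cong toℕ (sym e)) (monotone lt)))
               (≮⇒≥ (λ lt → <-irrefl (cong toℕ e) (monotone lt))))

  monotone⁻¹ : ∀ {i j} → toℕ (member i) < toℕ (member j) → toℕ i < toℕ j
  monotone⁻¹ {i} {j} lt = ≤∧≢⇒< (≮⇒≥ (λ gt → <-asym lt (monotone gt)))
    (λ e → <-irrefl (cong (toℕ ∘ member) (Finₚ.toℕ-injective e)) lt)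

  count≡ : count ≡ sum (λ z → ⟦ p z ⟧)
  count≡ = begin
    count                        ≡⟨ *-identityʳ count ⟨
    count * 1                    ≡⟨ sum-const count 1 ⟨
    sum {count} (λ _ → 1)        ≡⟨ sum-member (λ _ → 1) ⟩
    sum (λ z → ⟦ p z ⟧ * 1)      ≡⟨ sum-cong-≗ (λ z → *-identityʳ ⟦ p z ⟧) ⟩
    sum (λ z → ⟦ p z ⟧)          ∎
    where open ≡-Reasoning

  sum-member-≤ : ∀ F → sum (F ∘ member) ≤ sum F
  sum-member-≤ F = ≤-trans (≤-reflexive (sum-member F)) (sum-mono (λ z → ⟦⟧*≤ (p z) (F z)))

enumerate : ∀ {n} (p : Fin n → Bool) → Enumeration p
enumerate {zero} p = record
  { count = 0 ; member = λ () ; member-in = λ () ; monotone = λ { {()} }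
  ; sum-member = λ F → trans sum-zero (sym sum-zero) }
enumerate {suc n} p with enumerate (p ∘ suc) | p zero in p0
... | E | false = record
  { count = count ; member = suc ∘ member ; member-in = member-in ; monotone = s≤s ∘ monotone
  ; sum-member = λ F → begin
      sum (F ∘ suc ∘ member)                                ≡⟨ sum-member (F ∘ suc) ⟩
      sum (λ z → ⟦ p (suc z) ⟧ * F (suc z))                 ≡⟨ cong (λ b → ⟦ b ⟧ * F zero + sum (λ z → ⟦ p (suc z) ⟧ * F (suc z))) p0 ⟨
      ⟦ p zero ⟧ * F zero + sum (λ z → ⟦ p (suc z) ⟧ * F (suc z))  ≡⟨ sum-suc (λ z → ⟦ p z ⟧ * F z) ⟨
      sum (λ z → ⟦ p z ⟧ * F z)                             ∎ }
  where open Enumeration E ; open ≡-Reasoning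
... | E | true = record
  { count = suc count ; member = member' ; member-in = λ { zero → p0 ; (suc i) → member-in i }
  ; monotone = monotone'
  ; sum-member = λ F → begin
      sum (F ∘ member')                                     ≡⟨ sum-suc (F ∘ member') ⟩
      F zero + sum (F ∘ suc ∘ member)                       ≡⟨ cong₂ _+_ (sym (*-identityˡ _)) (sum-member (F ∘ suc)) ⟩
      1 * F zero + sum (λ z → ⟦ p (suc z) ⟧ * F (suc z))    ≡⟨ cong (λ b → ⟦ b ⟧ * F zero + sum (λ z → ⟦ p (suc z) ⟧ * F (suc z))) p0 ⟨
      ⟦ p zero ⟧ * F zero + sum (λ z → ⟦ p (suc z) ⟧ * F (suc z))  ≡⟨ sum-suc (λ z → ⟦ p z ⟧ * F z) ⟨
      sum (λ z → ⟦ p z ⟧ * F z)                             ∎ }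
  where
  open Enumeration E ; open ≡-Reasoning
  member' : Fin (suc count) → Fin (suc n)
  member' zero    = zero
  member' (suc i) = suc (member i)
  monotone' : ∀ {i j} → toℕ i < toℕ j → toℕ (member' i) < toℕ (member' j)
  monotone' {zero}  {suc j} _        = s≤s z≤n
  monotone' {suc i} {suc j} (s≤s lt) = s≤s (monotone lt)

-- A colouring is a map into `Fin 2`, so that `∑M` sums over all of them.
on : Fin 2 → Bool
on zero    = true
on (suc _) = false

agrees : Bool → Bool → Fin 2 → Bool
agrees false b     x = true
agrees true  true  x = on x
agrees true  false x = not (on x)

obeys : ∀ {n} → (Fin n → Bool) → (Fin n → Bool) → (Fin n → Fin 2) → Bool
obeys {zero}  Z val c = true
obeys {suc n} Z val c = agrees (Z zero) (val zero) (c zero) ∧ obeys (Z ∘ suc) (val ∘ suc) (c ∘ suc)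

obeys-sound : ∀ {n} (Z val : Fin n → Bool) c → obeys Z val c ≡ true → ∀ i → Z i ≡ true → on (c i) ≡ val i
obeys-sound {suc n} Z val c h (suc i) z = obeys-sound (Z ∘ suc) (val ∘ suc) (c ∘ suc) (proj₂ (∧-true h)) i z
obeys-sound {suc n} Z val c h zero z = agrees-sound (val zero) (c zero)
  (subst (λ b → agrees b (val zero) (c zero) ≡ true) z (proj₁ (∧-true h)))
  where
  agrees-sound : ∀ b x → agrees true b x ≡ true → on x ≡ b
  agrees-sound true  x       h = h
  agrees-sound false (suc _) h = refl

-- Each prescribed colour halves the number of colourings. This is the probability `2^-|Z|` with the
-- denominator cleared.
obeys-count : ∀ n (Z val : Fin n → Bool) →
  ∑M n (λ c → ⟦ obeys Z val c ⟧) * 2 ^ sum (λ i → ⟦ Z i ⟧) ≡ 2 ^ n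
obeys-count zero    Z val = cong (λ k → 1 * 2 ^ k) sum-zero
obeys-count (suc n) Z val = begin
  ∑M n (λ f → sum (λ x → ⟦ agrees z b x ∧ obeys Z' val' f ⟧)) * 2 ^ sum (λ i → ⟦ Z i ⟧)
    ≡⟨ cong₂ (λ s k → s * 2 ^ k)
         (trans (∑M-cong n (λ f → choices z b (obeys Z' val' f))) (∑M-*ˡ n (weight z) _))
         (sum-suc (λ i → ⟦ Z i ⟧)) ⟩
  weight z * N * 2 ^ (⟦ z ⟧ + r)  ≡⟨ cong (weight z * N *_) (^-distribˡ-+-* 2 ⟦ z ⟧ r) ⟩
  weight z * N * (2 ^ ⟦ z ⟧ * 2 ^ r)  ≡⟨ interchange (weight z) N (2 ^ ⟦ z ⟧) (2 ^ r) ⟩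
  weight z * 2 ^ ⟦ z ⟧ * (N * 2 ^ r)  ≡⟨ cong₂ _*_ (weight-2 z) (obeys-count n Z' val') ⟩
  2 * 2 ^ n ∎
  where
  open ≡-Reasoning
  z  = Z zero ; b = val zero ; Z' = Z ∘ suc ; val' = val ∘ suc
  N  = ∑M n (λ f → ⟦ obeys Z' val' f ⟧)
  r  = sum (λ i → ⟦ Z' i ⟧)
  interchange : ∀ a b c d → a * b * (c * d) ≡ a * c * (b * d)
  interchange = solve-∀
  weight : Bool → ℕ
  weight true  = 1
  weight false = 2
  weight-2 : ∀ z → weight z * 2 ^ ⟦ z ⟧ ≡ 2
  weight-2 true  = refl
  weight-2 false = refl
  sum-Fin2 : (f : Fin 2 → ℕ) → sum f ≡ f zero + f (suc zero)
  sum-Fin2 f = trans (sum-suc f) (cong (f zero +_)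
    (trans (sum-suc (f ∘ suc)) (trans (cong (f (suc zero) +_) sum-zero) (+-identityʳ _))))
  choices : ∀ z b s → sum (λ x → ⟦ agrees z b x ∧ s ⟧) ≡ weight z * ⟦ s ⟧
  choices z b s = trans (sum-Fin2 _) (cases z b s)
    where
    cases : ∀ z b s → ⟦ agrees z b zero ∧ s ⟧ + ⟦ agrees z b (suc zero) ∧ s ⟧ ≡ weight z * ⟦ s ⟧
    cases false b     s = cong (⟦ s ⟧ +_) (sym (+-identityʳ _))
    cases true  true  s = refl
    cases true  false s = sym (+-identityʳ _)

hits : ∀ {n k} → (Fin k → Fin n) → Fin n → Bool
hits s x = ⌊ Finₚ.any? (λ j → s j Fin.≟ x) ⌋

sum-hits≤ : ∀ {n k} (s : Fin k → Fin n) → sum (λ x → ⟦ hits s x ⟧) ≤ k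
sum-hits≤ {n} {k} s = begin
  sum (λ x → ⟦ hits s x ⟧)                        ≤⟨ sum-mono step ⟩
  sum (λ x → sum (λ j → ⟦ ⌊ s j Fin.≟ x ⌋ ⟧))     ≡⟨ ∑-comm (λ x j → ⟦ ⌊ s j Fin.≟ x ⌋ ⟧) ⟩
  sum (λ j → sum (λ x → ⟦ ⌊ s j Fin.≟ x ⌋ ⟧))     ≡⟨ sum-cong-≗ (λ j → sum-δ (s j)) ⟩
  sum {k} (λ _ → 1)                               ≡⟨ trans (sum-const k 1) (*-identityʳ k) ⟩
  k                                               ∎
  where
  open ≤-Reasoning
  step : ∀ x → ⟦ hits s x ⟧ ≤ sum (λ j → ⟦ ⌊ s j Fin.≟ x ⌋ ⟧)
  step x with Finₚ.any? (λ j → s j Fin.≟ x)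
  ... | no _        = z≤n
  ... | yes (j , e) = ≤-trans (≤-reflexive (sym (cong ⟦_⟧ (⌊⌋-true (s j Fin.≟ x) e)))) (term≤sum _ j)

-- The vertex `u` shows that at least one vertex is missed, so the at most `k` vertices hit number
-- at most `k` times those missed. This covers small `n` as well, where `n - k` would be useless.
many-misses : ∀ {n k} (s : Fin k → Fin n) u → (∀ j → s j ≢ u) → n ≤ suc k * sum (λ x → ⟦ not (hits s x) ⟧)
many-misses {n} {k} s u miss = begin
  n                                  ≡⟨ trans (sum-const n 1) (*-identityʳ n) ⟨
  sum {n} (λ _ → 1)                  ≡⟨ sum-cong-≗ (λ x → split (hits s x)) ⟩
  sum (λ x → ⟦ not (hits s x) ⟧ + ⟦ hits s x ⟧)  ≡⟨ ∑-distrib-+ (λ x → ⟦ not (hits s x) ⟧) (λ x → ⟦ hits s x ⟧) ⟩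
  M + sum (λ x → ⟦ hits s x ⟧)       ≤⟨ +-monoʳ-≤ M (sum-hits≤ s) ⟩
  M + k                              ≡⟨ cong (M +_) (*-identityʳ k) ⟨
  M + k * 1                          ≤⟨ +-monoʳ-≤ M (*-monoʳ-≤ k M≥1) ⟩
  M + k * M                          ∎
  where
  open ≤-Reasoning
  M = sum (λ x → ⟦ not (hits s x) ⟧)
  split : ∀ b → 1 ≡ ⟦ not b ⟧ + ⟦ b ⟧
  split true  = refl
  split false = refl
  M≥1 : 1 ≤ M
  M≥1 with hits s u in e | term≤sum (λ x → ⟦ not (hits s x) ⟧) u
  ... | true  | _ = let j , q = true-⌊⌋ (Finₚ.any? (λ j → s j Fin.≟ u)) e in ⊥-elim (miss j q)
  ... | false | h = h

avoids : ∀ {n k} → (Fin n → Bool) → (Fin k → Fin n) → Bool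
avoids c s = ⌊ Finₚ.all? (λ j → c (s j) Bool.≟ false) ⌋

kept : ∀ {n k} → (Fin n → Fin n → Bool) → (Fin n → Fin n → Fin k → Fin n) → (Fin n → Bool) →
  Fin n → Fin n → Bool
kept P S c u v = P u v ∧ (c u ∧ (c v ∧ avoids c (S u v)))

abstract
  -- The colours of `k + 3` vertices are prescribed: `k` in `S u v`, the two ends, and the extra
  -- coloured vertex. The factor `suc k` is the loss from taking the extra vertex outside `S u v`.
  density : ℕ → ℕ
  density k = suc k * 2 ^ (k + 3)

  density≡ : ∀ k → suc k * 2 ^ (k + 3) ≡ density k
  density≡ k = refl

  density-nonZero : ∀ k → NonZero (density k)
  density-nonZero k = m*n≢0 (suc k) (2 ^ (k + 3)) {{_}} {{m^n≢0 2 (k + 3)}}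

-- Averages over all 2ⁿ colourings. Counting pairs (kept edge, coloured vertex) makes both factors
-- large at once, which is needed because H may have isolated vertices.
good-colouring : ∀ {n k} (P : Fin n → Fin n → Bool) (S : Fin n → Fin n → Fin k → Fin n) →
  (∀ u v → P u v ≡ true → ∀ j → S u v j ≢ u × S u v j ≢ v) →
  ∃[ c ] (sum₂ (λ u v → ⟦ P u v ⟧) * n ≤ density k * (sum₂ (λ u v → ⟦ kept P S c u v ⟧) * sum (λ x → ⟦ c x ⟧)))
good-colouring {n} {k} P S avoid = on ∘ proj₁ found , (begin
  sum₂ (λ u v → ⟦ P u v ⟧) * n     ≤⟨ W-large ⟩
  suc k * W                        ≤⟨ *-monoʳ-≤ (suc k) (s≤s⁻¹ (proj₂ found)) ⟩
  suc k * (2 ^ r * Q (proj₁ found)) ≤⟨ *-monoʳ-≤ (suc k) (*-monoʳ-≤ (2 ^ r) (Q-small (proj₁ found))) ⟩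
  suc k * (2 ^ r * R (on ∘ proj₁ found)) ≡⟨ trans (sym (*-assoc (suc k) (2 ^ r) (R (on ∘ proj₁ found)))) (cong (_* R (on ∘ proj₁ found)) (density≡ k)) ⟩
  density k * R (on ∘ proj₁ found) ∎)
  where
  open ≤-Reasoning
  r = k + 3
  -- A vertex `x` on `S u v` would have to be both coloured and uncoloured, so only the other `x`
  -- are counted; by `many-misses` they are a fraction of at least `1/(k+1)`.
  w : Fin n → Fin n → Fin n → ℕ
  w u v x = ⟦ P u v ∧ not (hits (S u v) x) ⟧
  -- The event for the triple `u`, `v`, `x`: `S u v` is uncoloured while `u`, `v` and `x` are
  -- coloured. The two demands are compatible because `u`, `v` and `x` lie off `S u v`; coincidences
  -- such as `x = u` only shrink `Z`.
  Z : Fin n → Fin n → Fin n → Fin n → Bool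
  Z u v x i = hits (S u v) i ∨ (⌊ u Fin.≟ i ⌋ ∨ (⌊ v Fin.≟ i ⌋ ∨ ⌊ x Fin.≟ i ⌋))
  val : Fin n → Fin n → Fin n → Bool
  val u v i = not (hits (S u v) i)
  W : ℕ
  W = sum₂ (λ u v → sum (w u v))
  Q : (Fin n → Fin 2) → ℕ
  Q c = sum₂ (λ u v → sum (λ x → w u v x * ⟦ obeys (Z u v x) (val u v) c ⟧))
  R : (Fin n → Bool) → ℕ
  R c = sum₂ (λ u v → ⟦ kept P S c u v ⟧) * sum (λ x → ⟦ c x ⟧)

  misses : ∀ u v y → (∀ j → S u v j ≢ y) → hits (S u v) y ≡ false
  misses u v y h with Finₚ.any? (λ j → S u v j Fin.≟ y)
  ... | yes (j , e) = ⊥-elim (h j e)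
  ... | no _        = refl

  W-large : sum₂ (λ u v → ⟦ P u v ⟧) * n ≤ suc k * W
  W-large = begin
    sum₂ (λ u v → ⟦ P u v ⟧) * n          ≡⟨ sum₂-*ʳ n (λ u v → ⟦ P u v ⟧) ⟨
    sum₂ (λ u v → ⟦ P u v ⟧ * n)          ≤⟨ sum₂-mono (λ u v → step u v (P u v) refl) ⟩
    sum₂ (λ u v → suc k * sum (w u v))    ≡⟨ sum₂-*ˡ (suc k) (λ u v → sum (w u v)) ⟩
    suc k * W                             ∎
    where
    step : ∀ u v b → P u v ≡ b → ⟦ b ⟧ * n ≤ suc k * sum (λ x → ⟦ P u v ∧ not (hits (S u v) x) ⟧)
    step u v false e = z≤n
    step u v true  e rewrite e = ≤-trans (≤-reflexive (*-identityˡ n))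
      (many-misses (S u v) u (λ j → proj₁ (avoid u v e j)))

  constrained≤ : ∀ u v x → sum (λ i → ⟦ Z u v x i ⟧) ≤ r
  constrained≤ u v x = begin
    sum (λ i → ⟦ Z u v x i ⟧)  ≤⟨ sum-mono (λ i → ≤-trans (⟦∨⟧≤ (hits (S u v) i) _) (+-monoʳ-≤ ⟦ hits (S u v) i ⟧
                                    (≤-trans (⟦∨⟧≤ ⌊ u Fin.≟ i ⌋ _) (+-monoʳ-≤ ⟦ ⌊ u Fin.≟ i ⌋ ⟧ (⟦∨⟧≤ ⌊ v Fin.≟ i ⌋ _))))) ⟩
    sum (λ i → ⟦ hits (S u v) i ⟧ + (δ u i + (δ v i + δ x i)))
      ≡⟨ ∑-distrib-+ (λ i → ⟦ hits (S u v) i ⟧) _ ⟩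
    sum (λ i → ⟦ hits (S u v) i ⟧) + sum (λ i → δ u i + (δ v i + δ x i))
      ≤⟨ +-mono-≤ (sum-hits≤ (S u v)) (≤-reflexive (trans (∑-distrib-+ (δ u) _)
           (cong₂ _+_ (sum-δ u) (trans (∑-distrib-+ (δ v) (δ x)) (cong₂ _+_ (sum-δ v) (sum-δ x)))))) ⟩
    k + 3 ∎
    where
    δ : Fin n → Fin n → ℕ
    δ y i = ⟦ ⌊ y Fin.≟ i ⌋ ⟧

  expected : ∀ u v x → 2 ^ n * w u v x ≤ 2 ^ r * ∑M n (λ c → w u v x * ⟦ obeys (Z u v x) (val u v) c ⟧)
  expected u v x = begin
    2 ^ n * w u v x          ≡⟨ cong (_* w u v x) (obeys-count n (Z u v x) (val u v)) ⟨
    N * 2 ^ sum (λ i → ⟦ Z u v x i ⟧) * w u v x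
                             ≤⟨ *-monoˡ-≤ (w u v x) (*-monoʳ-≤ N (^-monoʳ-≤ 2 (constrained≤ u v x))) ⟩
    N * 2 ^ r * w u v x      ≡⟨ rearrange N (2 ^ r) (w u v x) ⟩
    2 ^ r * (w u v x * N)    ≡⟨ cong (2 ^ r *_) (∑M-*ˡ n (w u v x) _) ⟨
    2 ^ r * ∑M n (λ c → w u v x * ⟦ obeys (Z u v x) (val u v) c ⟧) ∎
    where
    N = ∑M n (λ c → ⟦ obeys (Z u v x) (val u v) c ⟧)
    rearrange : ∀ a b c → a * b * c ≡ b * (c * a)
    rearrange = solve-∀

  ∑M-const : ∀ y → ∑M n {2} (λ _ → y) ≡ 2 ^ n * y
  ∑M-const y = go n
    where
    go : ∀ n → ∑M n {2} (λ _ → y) ≡ 2 ^ n * y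
    go zero    = sym (+-identityʳ y)
    go (suc n) = trans (∑M-cong n (λ _ → sum-const 2 y))
      (trans (∑M-*ˡ n 2 (λ _ → y)) (trans (cong (2 *_) (go n)) (sym (*-assoc 2 (2 ^ n) y))))

  average : 2 ^ n * W ≤ 2 ^ r * ∑M n Q
  average = begin
    2 ^ n * W  ≡⟨ sum₂-*ˡ (2 ^ n) _ ⟨
    sum₂ (λ u v → 2 ^ n * sum (w u v))  ≡⟨ sum₂-cong (λ u v → *-distribˡ-sum (2 ^ n) (w u v)) ⟩
    sum₂ (λ u v → sum (λ x → 2 ^ n * w u v x))  ≤⟨ sum₂-mono (λ u v → sum-mono (expected u v)) ⟩
    sum₂ (λ u v → sum (λ x → 2 ^ r * T u v x))  ≡⟨ sum₂-cong (λ u v → *-distribˡ-sum (2 ^ r) (T u v)) ⟨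
    sum₂ (λ u v → 2 ^ r * sum (T u v))  ≡⟨ sum₂-*ˡ (2 ^ r) _ ⟩
    2 ^ r * sum₂ (λ u v → sum (T u v))  ≡⟨ cong (2 ^ r *_) (sum₂-cong (λ u v → ∑M-sum-comm n _)) ⟨
    2 ^ r * sum₂ (λ u v → ∑M n (λ c → sum (λ x → w u v x * ⟦ obeys (Z u v x) (val u v) c ⟧)))
      ≡⟨ cong (2 ^ r *_) (∑M-sum₂-comm n _) ⟨
    2 ^ r * ∑M n Q ∎
    where
    T : Fin n → Fin n → Fin n → ℕ
    T u v x = ∑M n (λ c → w u v x * ⟦ obeys (Z u v x) (val u v) c ⟧)

  -- Adding 1 for every colouring makes the averaged inequality strict, as choosing a colouring
  -- requires; the result still says `W ≤ 2 ^ r * Q c`.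
  found : ∃[ c ] W < suc (2 ^ r * Q c)
  found = ∑M-exists-< n (begin-strict
    ∑M n {2} (λ _ → W)  ≡⟨ ∑M-const W ⟩
    2 ^ n * W           ≤⟨ average ⟩
    2 ^ r * ∑M n Q      ≡⟨ ∑M-*ˡ n (2 ^ r) Q ⟨
    ∑M n (λ c → 2 ^ r * Q c)  <⟨ +-monoˡ-< _ (subst (0 <_) (sym (trans (∑M-const 1) (*-identityʳ (2 ^ n)))) (m^n>0 2 n)) ⟩
    ∑M n (λ _ → 1) + ∑M n (λ c → 2 ^ r * Q c)  ≡⟨ ∑M-distrib-+ n (λ _ → 1) (λ c → 2 ^ r * Q c) ⟨
    ∑M n (λ c → suc (2 ^ r * Q c)) ∎)

  Q-small : ∀ c → Q c ≤ R (on ∘ c)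
  Q-small c = begin
    Q c  ≤⟨ sum₂-mono (λ u v → sum-mono (step u v)) ⟩
    sum₂ (λ u v → sum (λ x → ⟦ kept P S (on ∘ c) u v ⟧ * ⟦ on (c x) ⟧))
      ≡⟨ sum₂-cong (λ u v → *-distribˡ-sum ⟦ kept P S (on ∘ c) u v ⟧ (λ x → ⟦ on (c x) ⟧)) ⟨
    sum₂ (λ u v → ⟦ kept P S (on ∘ c) u v ⟧ * sum (λ x → ⟦ on (c x) ⟧))  ≡⟨ sum₂-*ʳ _ (λ u v → ⟦ kept P S (on ∘ c) u v ⟧) ⟩
    R (on ∘ c) ∎
    where
    implies : ∀ u v x → (P u v ∧ not (hits (S u v) x)) ∧ obeys (Z u v x) (val u v) c ≡ true →
      kept P S (on ∘ c) u v ∧ on (c x) ≡ true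
    implies u v x h = true-∧ (true-∧ p (true-∧ (colour u (true-∨ʳ {hits (S u v) u} (true-∨ˡ (⌊⌋-true (u Fin.≟ u) refl)))
                                                       (misses u v u (λ j → proj₁ (avoid u v p j))))
                                (true-∧ (colour v (true-∨ʳ {hits (S u v) v} (true-∨ʳ {⌊ u Fin.≟ v ⌋} (true-∨ˡ (⌊⌋-true (v Fin.≟ v) refl))))
                                                       (misses u v v (λ j → proj₂ (avoid u v p j))))
                                        (⌊⌋-true (Finₚ.all? _) off))))
                             (colour x (true-∨ʳ {hits (S u v) x} (true-∨ʳ {⌊ u Fin.≟ x ⌋} (true-∨ʳ {⌊ v Fin.≟ x ⌋} (⌊⌋-true (x Fin.≟ x) refl))))
                                       (true-not (proj₂ (∧-true {P u v} (proj₁ (∧-true h))))))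
      where
      p = proj₁ (∧-true {P u v} (proj₁ (∧-true h)))
      sound = obeys-sound (Z u v x) (val u v) c (proj₂ (∧-true {P u v ∧ not (hits (S u v) x)} h))
      colour : ∀ y → Z u v x y ≡ true → hits (S u v) y ≡ false → on (c y) ≡ true
      colour y z m = trans (sound y z) (cong not m)
      off : ∀ j → on (c (S u v j)) ≡ false
      off j = trans (sound (S u v j) (true-∨ˡ hit)) (cong not hit)
        where
        hit : hits (S u v) (S u v j) ≡ true
        hit = ⌊⌋-true (Finₚ.any? _) (j , refl)
    step : ∀ u v x → w u v x * ⟦ obeys (Z u v x) (val u v) c ⟧ ≤ ⟦ kept P S (on ∘ c) u v ⟧ * ⟦ on (c x) ⟧
    step u v x = subst₂ _≤_ (⟦∧⟧ (P u v ∧ not (hits (S u v) x)) _) (⟦∧⟧ (kept P S (on ∘ c) u v) _) (⟦⟧-mono (implies u v x))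

-- Edges with many extensions

module _ {v : ℕ} {a b : Fin v} (ρ : Rooting a b) where
  open Rooting ρ

  slot-a : slot a ≡ left
  slot-a = trans (cong slot (sym unslot-left)) (slot-unslot left)

  slot-b : slot b ≡ right
  slot-b = trans (cong slot (sym unslot-right)) (slot-unslot right)

  slot-injective : ∀ {i j} → slot i ≡ slot j → i ≡ j
  slot-injective e = trans (sym (unslot-slot _)) (trans (cong unslot e) (unslot-slot _))

  fill-natural : ∀ {A B : Set} (h : A → B) {w} x y (g : Fin w → A) s → h (fill x y g s) ≡ fill (h x) (h y) (h ∘ g) s
  fill-natural h x y g left     = refl
  fill-natural h x y g right    = refl
  fill-natural h x y g (free j) = refl

  place-natural : ∀ {A B : Set} (h : A → B) o x y (g : Fin rest → A) i →
    h (place o x y g i) ≡ place o (h x) (h y) (h ∘ g) i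
  place-natural h false x y g i = fill-natural h x y g (slot i)
  place-natural h true  x y g i = fill-natural h y x g (slot i)

  fill-cong : ∀ {A : Set} {w} (x y : A) {f g : Fin w → A} → (∀ i → f i ≡ g i) → ∀ s → fill x y f s ≡ fill x y g s
  fill-cong x y h left     = refl
  fill-cong x y h right    = refl
  fill-cong x y h (free j) = h j

  place-cong : ∀ {A : Set} o (x y : A) {f g : Fin rest → A} → (∀ i → f i ≡ g i) → ∀ i → place o x y f i ≡ place o x y g i
  place-cong false x y h i = fill-cong x y h (slot i)
  place-cong true  x y h i = fill-cong y x h (slot i)

  place-a : ∀ {A : Set} o (x y : A) (g : Fin rest → A) → place o x y g a ≡ orient o (λ p _ → p) x y
  place-a false x y g = cong (fill x y g) slot-a
  place-a true  x y g = cong (fill y x g) slot-a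

  place-b : ∀ {A : Set} o (x y : A) (g : Fin rest → A) → place o x y g b ≡ orient o (λ _ q → q) x y
  place-b false x y g = cong (fill x y g) slot-b
  place-b true  x y g = cong (fill y x g) slot-b

disjoint : ∀ {n w k} → (Fin w → Fin n) → (Fin k → Fin n) → Bool
disjoint g s = ⌊ Finₚ.all? (λ i → Finₚ.all? (λ j → ¬? (g i Fin.≟ s j))) ⌋

disjoint-sound : ∀ {n w k} (g : Fin w → Fin n) (s : Fin k → Fin n) → disjoint g s ≡ true → ∀ i j → g i ≢ s j
disjoint-sound g s h = true-⌊⌋ (Finₚ.all? (λ i → Finₚ.all? (λ j → ¬? (g i Fin.≟ s j)))) h

disjoint-complete : ∀ {n w k} (g : Fin w → Fin n) (s : Fin k → Fin n) → (∀ i j → g i ≢ s j) → disjoint g s ≡ true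
disjoint-complete g s h = ⌊⌋-true (Finₚ.all? (λ i → Finₚ.all? (λ j → ¬? (g i Fin.≟ s j)))) h

module _ {v n : ℕ} {a b : Fin v} (H : Graph v) (G : Graph n) (ρ : Rooting a b) where
  open Rooting ρ

  extends : ∀ {k} → Bool → Fin n → Fin n → (Fin k → Fin n) → (Fin rest → Fin n) → Bool
  extends o x y s g = isCopy H G (place o x y g) ∧ disjoint g s

  -- Both orientations are counted because the edge `xy` is unordered: `a` may go to either end.
  extensions : ∀ {k} → Fin n → Fin n → (Fin k → Fin n) → ℕ
  extensions x y s = ∑M rest (λ g → ⟦ extends false x y s g ⟧ + ⟦ extends true x y s g ⟧)

  extends-ext : ∀ {k} o x y (s : Fin k → Fin n) → Extensional (λ g → ⟦ extends o x y s g ⟧)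
  extends-ext o x y s {f} {g} h = begin
    ⟦ extends o x y s f ⟧  ≡⟨ ⟦∧⟧ (isCopy H G (place o x y f)) _ ⟩
    ⟦ isCopy H G (place o x y f) ⟧ * ⟦ disjoint f s ⟧
      ≡⟨ cong₂ _*_ (isCopy-ext H G (place-cong ρ o x y h))
           (⟦⟧-cong (transfer f g h) (transfer g f (λ i → sym (h i)))) ⟩
    ⟦ isCopy H G (place o x y g) ⟧ * ⟦ disjoint g s ⟧  ≡⟨ ⟦∧⟧ (isCopy H G (place o x y g)) _ ⟨
    ⟦ extends o x y s g ⟧ ∎
    where
    open ≡-Reasoning
    transfer : ∀ f g → (∀ i → f i ≡ g i) → disjoint f s ≡ true → disjoint g s ≡ true
    transfer f g h d = disjoint-complete g s (λ i j e → disjoint-sound f s d i j (trans (h i) e))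

^-distribʳ-* : ∀ k x y → (x * y) ^ k ≡ x ^ k * y ^ k
^-distribʳ-* zero    x y = refl
^-distribʳ-* (suc k) x y = trans (cong (x * y *_) (^-distribʳ-* k x y)) (interchange x y (x ^ k) (y ^ k))
  where
  interchange : ∀ a b c d → a * b * (c * d) ≡ a * c * (b * d)
  interchange = solve-∀

edges>0⇒n>0 : ∀ {n} (G : Graph n) → 0 < edges G → 0 < n
edges>0⇒n>0 {suc n} G _ = s≤s z≤n
edges>0⇒n>0 {zero}  G h = ⊥-elim (<-irrefl (sym (trans (edges≡sum₂ G) sum-zero)) h)

-- The 4 comes from starting with a quarter of the edges, `density k` from the colouring.
dilution : ℕ → ℕ
dilution k = 4 * density k

-- `Dense` stands for the edge threshold of `H` and `B` for a bound on `1/β`; keeping the threshold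
-- opaque leaves pure counting in ℕ.
module _ {v : ℕ} (H : Graph v) {a b : Fin v} (ab : adj H a b ≡ true) (ρ : Rooting a b)
         (e : ℕ) (edgesH : edges H ≡ suc e)
         (Dense : ℕ → ℕ → Set) (B : ℕ)
         (many : ∀ n (G : Graph n) → Dense n (edges G) →
                 edges G ^ edges H * n ^ v ≤ B * (copies H G * n ^ (2 * edges H)))
  where
  open Rooting ρ

  -- Averaging: every copy of `H` sends `ab` to some edge, so among the edges one carries at least
  -- the mean number of copies. The root edge accounts for a factor `m` and, on both sides, for a
  -- factor `n²` that is cancelled.
  heavy-edge : ∀ {n} (G : Graph n) (E : Fin n → Fin n → Bool) →
    (∀ x y → (adj G x y ∧ x <ᵇᶠ y) ≡ E x y) → Dense n (edges G) → 0 < edges G →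
    ∃[ x ] ∃[ y ] (E x y ≡ true × edges G ^ e * n ^ rest ≤
      B * (∑M rest (λ g → ⟦ isCopy H G (place false x y g) ⟧ + ⟦ isCopy H G (place true x y g) ⟧) * n ^ (2 * e)))
  heavy-edge {n} G E E-edges dense pos = heavy-pair E X (λ x y → B * (q² x y * N)) (subst (0 <_) m≡ pos) (begin
    sum₂ (λ x y → ⟦ E x y ⟧) * X  ≡⟨ cong (_* X) m≡ ⟨
    m * X  ≤⟨ *-cancelʳ-≤ (m * X) (B * (copies H G * N)) (n * n) bound ⟩
    B * (copies H G * N)  ≤⟨ *-monoʳ-≤ B (*-monoˡ-≤ N copies≤) ⟩
    B * (sum₂ (λ x y → ⟦ E x y ⟧ * q² x y) * N)  ≡⟨ cong (B *_) (sum₂-*ʳ N (λ x y → ⟦ E x y ⟧ * q² x y)) ⟨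
    B * sum₂ (λ x y → ⟦ E x y ⟧ * q² x y * N)  ≡⟨ sum₂-*ˡ B (λ x y → ⟦ E x y ⟧ * q² x y * N) ⟨
    sum₂ (λ x y → B * (⟦ E x y ⟧ * q² x y * N))  ≡⟨ sum₂-cong (λ x y → rearrange B ⟦ E x y ⟧ (q² x y) N) ⟩
    sum₂ (λ x y → ⟦ E x y ⟧ * (B * (q² x y * N))) ∎)
    where
    open ≤-Reasoning
    m = edges G
    X = m ^ e * n ^ rest
    N = n ^ (2 * e)
    q q² : Fin n → Fin n → ℕ
    q x y = ∑M rest (λ g → ⟦ isCopy H G (place false x y g) ⟧)
    q² x y = ∑M rest (λ g → ⟦ isCopy H G (place false x y g) ⟧ + ⟦ isCopy H G (place true x y g) ⟧)

    rearrange : ∀ b s q N → b * (s * q * N) ≡ s * (b * (q * N))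
    rearrange = solve-∀

    m≡ : m ≡ sum₂ (λ x y → ⟦ E x y ⟧)
    m≡ = trans (edges≡sum₂ G) (sum₂-cong (λ x y → cong ⟦_⟧ (E-edges x y)))

    instance
      n≢0 : NonZero n
      n≢0 = >-nonZero (edges>0⇒n>0 G pos)
      n²≢0 : NonZero (n * n)
      n²≢0 = m*n≢0 n n

    bound : m * X * (n * n) ≤ B * (copies H G * N) * (n * n)
    bound = begin
      m * X * (n * n)  ≡⟨ lhs m (m ^ e) (n ^ rest) n ⟩
      m ^ suc e * n ^ (2 + rest)  ≡⟨ cong₂ (λ i j → m ^ i * n ^ j) edgesH size ⟨
      m ^ edges H * n ^ v  ≤⟨ many n G dense ⟩
      B * (copies H G * n ^ (2 * edges H))  ≡⟨ cong (λ i → B * (copies H G * n ^ i)) (trans (cong (2 *_) edgesH) (*-suc 2 e)) ⟩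
      B * (copies H G * n ^ (2 + 2 * e))  ≡⟨ rhs B (copies H G) n N ⟩
      B * (copies H G * N) * (n * n) ∎
      where
      lhs : ∀ m x y n → m * (x * y) * (n * n) ≡ m * x * (n * (n * y))
      lhs = solve-∀
      rhs : ∀ b c n y → b * (c * (n * (n * y))) ≡ b * (c * y) * (n * n)
      rhs = solve-∀

    -- Copies rooted at a non-edge do not exist since `ab` is an edge of `H`; taking `x = y` gives
    -- the vanishing diagonal that `≤-unordered-sum` asks for.
    q-zero : ∀ x y → adj G x y ≡ false → q x y ≡ 0
    q-zero x y nadj = trans (∑M-cong rest (λ g → zero-at g)) (∑M-*ˡ rest 0 (λ _ → 0))
      where
      zero-at : ∀ g → ⟦ isCopy H G (place false x y g) ⟧ ≡ 0 * 0
      zero-at g = n≤0⇒n≡0 (⟦⟧-mono {c = false} (λ c → ⊥-elim (true≢false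
        (subst₂ (λ p q → adj G p q ≡ true) (place-a ρ false x y g) (place-b ρ false x y g)
          (proj₂ (isCopy-sound H G _ c) a b ab)) nadj)))

    copies≤ : copies H G ≤ sum₂ (λ x y → ⟦ E x y ⟧ * q² x y)
    copies≤ = begin
      copies H G  ≡⟨ copies≡∑M H G ⟩
      ∑M v (λ f → ⟦ isCopy H G f ⟧)  ≡⟨ decompose _ (isCopy-ext H G) ⟩
      ∑M rest (λ g → sum₂ (λ x y → ⟦ isCopy H G (place false x y g) ⟧))  ≡⟨ ∑M-sum₂-comm rest _ ⟩
      sum₂ q  ≤⟨ ≤-unordered-sum q (λ x → q-zero x x (irrefl G x)) ⟩
      sum₂ (λ x y → ⟦ x <ᵇᶠ y ⟧ * (q x y + q y x))  ≤⟨ sum₂-mono step ⟩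
      sum₂ (λ x y → ⟦ E x y ⟧ * (q x y + q y x))
        ≡⟨ sum₂-cong (λ x y → cong (⟦ E x y ⟧ *_) (∑M-distrib-+ rest _ _)) ⟨
      sum₂ (λ x y → ⟦ E x y ⟧ * q² x y) ∎
      where
      step : ∀ x y → ⟦ x <ᵇᶠ y ⟧ * (q x y + q y x) ≤ ⟦ E x y ⟧ * (q x y + q y x)
      step x y with adj G x y in eq | E-edges x y
      ... | true  | r rewrite r = ≤-refl
      ... | false | r rewrite q-zero x y eq | q-zero y x (trans (Graph.sym G y x) eq)
                            | *-zeroʳ ⟦ x <ᵇᶠ y ⟧ = z≤n

  -- A loss of `κ` in edges enters with power `e`, a loss of `κ` in vertices with power `rest`.
  spread : ℕ → ℕ
  spread κ = κ ^ e * κ ^ rest * B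

  -- Goodness is applied to G', the kept edges on the coloured vertices only: its copies avoid S u v.
  module Diluted {n k d : ℕ} (G : Graph n) (P : Fin n → Fin n → Bool) (S : Fin n → Fin n → Fin k → Fin n)
    (c : Fin n → Bool) (enumeration : Enumeration c)
    (coloured : sum₂ (λ u v → ⟦ P u v ⟧) * n ≤
                d * (sum₂ (λ u v → ⟦ kept P S c u v ⟧) * sum (λ x → ⟦ c x ⟧)))
    (κ : ℕ) (κ≡ : 4 * d ≡ κ)
    (dense : ∀ {n' m'} → n' ≤ n → edges G ≤ κ * m' → Dense n' m') (pos : 0 < edges G)
    (P-edge : ∀ u v → P u v ≡ true → adj G u v ≡ true × toℕ u < toℕ v)
    (large : edges G ≤ 4 * sum₂ (λ u v → ⟦ P u v ⟧)) where
    open Enumeration enumeration renaming (member to ι; count to n₀)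
    open ≤-Reasoning
    m = edges G
    P' : Fin n → Fin n → Bool
    P' = kept P S c

    P'⇒P : ∀ {u v} → P' u v ≡ true → P u v ≡ true
    P'⇒P h = proj₁ (∧-true h)

    P'-irrefl : ∀ u → P' u u ≡ false
    P'-irrefl u with P' u u in eq
    ... | true  = ⊥-elim (<-irrefl refl (proj₂ (P-edge u u (P'⇒P eq))))
    ... | false = refl

    G' : Graph n₀
    G' = record
      { adj    = λ x y → P' (ι x) (ι y) ∨ P' (ι y) (ι x)
      ; sym    = λ x y → Boolₚ.∨-comm (P' (ι x) (ι y)) (P' (ι y) (ι x))
      ; irrefl = λ x → cong₂ _∨_ (P'-irrefl (ι x)) (P'-irrefl (ι x)) }

    -- `P` holds for increasing pairs only and `ι` is increasing, so of the two disjuncts in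
    -- `adj G'` the one in the wrong order fails.
    G'-edges : ∀ x y → (adj G' x y ∧ x <ᵇᶠ y) ≡ P' (ι x) (ι y)
    G'-edges x y with P' (ι x) (ι y) in eq
    ... | true = ⌊⌋-true (toℕ x <? toℕ y) (monotone⁻¹ (proj₂ (P-edge _ _ (P'⇒P eq))))
    ... | false with P' (ι y) (ι x) in eq'
    ... | false = refl
    ... | true with toℕ x <? toℕ y
    ... | no _   = refl
    ... | yes lt = ⊥-elim (<-asym (monotone lt) (proj₂ (P-edge _ _ (P'⇒P eq'))))

    m' = edges G'

    -- Reindexing along `ι` introduces the weights `⟦ c u ⟧` and `⟦ c v ⟧`, which are absorbed
    -- because a kept edge has coloured ends.
    m'≡ : m' ≡ sum₂ (λ u v → ⟦ P' u v ⟧)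
    m'≡ = begin-equality
      m'  ≡⟨ edges≡sum₂ G' ⟩
      sum₂ (λ x y → ⟦ adj G' x y ∧ x <ᵇᶠ y ⟧)  ≡⟨ sum₂-cong (λ x y → cong ⟦_⟧ (G'-edges x y)) ⟩
      sum₂ (λ x y → ⟦ P' (ι x) (ι y) ⟧)  ≡⟨ sum-cong-≗ (λ x → sum-member (λ v → ⟦ P' (ι x) v ⟧)) ⟩
      sum (λ x → sum (λ v → ⟦ c v ⟧ * ⟦ P' (ι x) v ⟧))  ≡⟨ sum-member (λ u → sum (λ v → ⟦ c v ⟧ * ⟦ P' u v ⟧)) ⟩
      sum (λ u → ⟦ c u ⟧ * sum (λ v → ⟦ c v ⟧ * ⟦ P' u v ⟧))  ≡⟨ sum-cong-≗ (λ u → *-distribˡ-sum ⟦ c u ⟧ _) ⟩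
      sum₂ (λ u v → ⟦ c u ⟧ * (⟦ c v ⟧ * ⟦ P' u v ⟧))  ≡⟨ sum₂-cong step ⟩
      sum₂ (λ u v → ⟦ P' u v ⟧) ∎
      where
      step : ∀ u v → ⟦ c u ⟧ * (⟦ c v ⟧ * ⟦ P' u v ⟧) ≡ ⟦ P' u v ⟧
      step u v with c u | c v | P u v
      ... | true  | true  | true  = trans (*-identityˡ _) (*-identityˡ _)
      ... | true  | true  | false = refl
      ... | true  | false | true  = refl
      ... | true  | false | false = refl
      ... | false | _     | true  = refl
      ... | false | _     | false = refl

    -- Both losses are read off this one inequality: replacing `n₀` by `n` and cancelling gives
    -- `m ≤ κ * m'`, replacing `m'` by `m` and cancelling gives `n ≤ κ * n₀`.
    product : m * n ≤ κ * (m' * n₀)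
    product = begin
      m * n  ≤⟨ *-monoˡ-≤ n large ⟩
      4 * p * n  ≡⟨ *-assoc 4 p n ⟩
      4 * (p * n)  ≤⟨ *-monoʳ-≤ 4 coloured ⟩
      4 * (d * (p' * n'))  ≡⟨ *-assoc 4 d (p' * n') ⟨
      4 * d * (p' * n')  ≡⟨ cong₂ _*_ κ≡ (sym (cong₂ _*_ m'≡ count≡)) ⟩
      κ * (m' * n₀) ∎
      where
      p  = sum₂ (λ u v → ⟦ P u v ⟧)
      p' = sum₂ (λ u v → ⟦ P' u v ⟧)
      n' = sum (λ x → ⟦ c x ⟧)

    m'≤m : m' ≤ m
    m'≤m = begin
      m'  ≡⟨ m'≡ ⟩
      sum₂ (λ u v → ⟦ P' u v ⟧)  ≤⟨ sum₂-mono (λ u v → ⟦⟧-mono (λ h →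
                                      let p , lt = P-edge u v (P'⇒P h) in true-∧ p (⌊⌋-true (toℕ u <? toℕ v) lt))) ⟩
      sum₂ (λ u v → ⟦ adj G u v ∧ u <ᵇᶠ v ⟧)  ≡⟨ edges≡sum₂ G ⟨
      m ∎

    n₀≤n : n₀ ≤ n
    n₀≤n = begin
      n₀  ≡⟨ count≡ ⟩
      sum (λ x → ⟦ c x ⟧)  ≤⟨ sum-mono (λ x → ⟦⟧≤1 (c x)) ⟩
      sum {n} (λ _ → 1)  ≡⟨ trans (sum-const n 1) (*-identityʳ n) ⟩
      n ∎

    instance
      m≢0 : NonZero m
      m≢0 = >-nonZero pos
      n≢0 : NonZero n
      n≢0 = >-nonZero (edges>0⇒n>0 G pos)

    m≤κm' : m ≤ κ * m'
    m≤κm' = *-cancelʳ-≤ m (κ * m') n (≤-trans product (≤-trans (≤-reflexive (sym (*-assoc κ m' n₀))) (*-monoʳ-≤ (κ * m') n₀≤n)))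

    n≤κn₀ : n ≤ κ * n₀
    n≤κn₀ = *-cancelˡ-≤ m (begin
      m * n  ≤⟨ product ⟩
      κ * (m' * n₀)  ≤⟨ *-monoʳ-≤ κ (*-monoˡ-≤ n₀ m'≤m) ⟩
      κ * (m * n₀)  ≡⟨ swap κ m n₀ ⟩
      m * (κ * n₀) ∎)
      where
      swap : ∀ a b c → a * (b * c) ≡ b * (a * c)
      swap = solve-∀

    m'>0 : 0 < m'
    m'>0 = n≢0⇒n>0 (λ eq → <⇒≱ pos (≤-trans m≤κm' (≤-reflexive (trans (cong (κ *_) eq) (*-zeroʳ κ)))))

    G'⇒G : ∀ x y → adj G' x y ≡ true → adj G (ι x) (ι y) ≡ true
    G'⇒G x y h with ∨-true {P' (ι x) (ι y)} {P' (ι y) (ι x)} h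
    ... | inj₁ p = proj₁ (P-edge (ι x) (ι y) (P'⇒P p))
    ... | inj₂ p = trans (Graph.sym G (ι x) (ι y)) (proj₁ (P-edge (ι y) (ι x) (P'⇒P p)))

    P'-avoids : ∀ u v → P' u v ≡ true → ∀ j → c (S u v j) ≡ false
    P'-avoids u v h = true-⌊⌋ (Finₚ.all? (λ j → c (S u v j) Bool.≟ false))
      (proj₂ (∧-true {c v} (proj₂ (∧-true {c u} (proj₂ (∧-true {P u v} h))))))

    -- The vertices of `G'` are coloured and `S` of a kept edge is not, so the free vertices of the
    -- copy miss it without further counting.
    lift : ∀ o x y g → P' (ι x) (ι y) ≡ true → isCopy H G' (place o x y g) ≡ true →
      extends H G ρ o (ι x) (ι y) (S (ι x) (ι y)) (ι ∘ g) ≡ true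
    lift o x y g h copy = true-∧ (isCopy-complete H G φ (φ-injective , φ-hom)) (disjoint-complete (ι ∘ g) s off)
      where
      s = S (ι x) (ι y)
      ψ : Fin v → Fin n₀
      ψ = place o x y g
      φ : Fin v → Fin n
      φ = place o (ι x) (ι y) (ι ∘ g)
      copy-ψ : IsCopy H G' ψ
      copy-ψ = isCopy-sound H G' ψ copy
      ι∘ψ : ∀ i → ι (ψ i) ≡ φ i
      ι∘ψ = place-natural ρ ι o x y g
      φ-injective : ∀ i j → φ i ≡ φ j → i ≡ j
      φ-injective i j eq = proj₁ copy-ψ i j (member-injective (ψ i) (ψ j) (trans (ι∘ψ i) (trans eq (sym (ι∘ψ j)))))
      φ-hom : ∀ i j → adj H i j ≡ true → adj G (φ i) (φ j) ≡ true
      φ-hom i j h = subst₂ (λ x y → adj G x y ≡ true) (ι∘ψ i) (ι∘ψ j) (G'⇒G (ψ i) (ψ j) (proj₂ copy-ψ i j h))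
      off : ∀ i j → ι (g i) ≢ s j
      off i j eq = true≢false (member-in (g i)) (trans (cong c eq) (P'-avoids (ι x) (ι y) h j))

    q² : Fin n₀ → Fin n₀ → ℕ
    q² x y = ∑M rest (λ g → ⟦ isCopy H G' (place false x y g) ⟧ + ⟦ isCopy H G' (place true x y g) ⟧)
    q²≤ : ∀ x y → P' (ι x) (ι y) ≡ true → q² x y ≤ extensions H G ρ (ι x) (ι y) (S (ι x) (ι y))
    q²≤ x y p' = begin
      q² x y  ≤⟨ ∑M-mono rest (λ g → +-mono-≤ (⟦⟧-mono (lift false x y g p')) (⟦⟧-mono (lift true x y g p'))) ⟩
      ∑M rest (λ g → F (ι ∘ g))  ≤⟨ ∑M-inject rest ι sum-member-≤ F
                                      (λ h → cong₂ _+_ (extends-ext H G ρ false (ι x) (ι y) s h) (extends-ext H G ρ true (ι x) (ι y) s h)) ⟩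
      ∑M rest F ∎
      where
      s = S (ι x) (ι y)
      F : (Fin rest → Fin n) → ℕ
      F g = ⟦ extends H G ρ false (ι x) (ι y) s g ⟧ + ⟦ extends H G ρ true (ι x) (ι y) s g ⟧
    interchange : ∀ a b c d → a * b * (c * d) ≡ a * c * (b * d)
    interchange = solve-∀
    bound-lifts : ∀ x y → P' (ι x) (ι y) ≡ true →
      m' ^ e * n₀ ^ rest ≤ B * (q² x y * n₀ ^ (2 * e)) →
      m ^ e * n ^ rest ≤ spread κ * (extensions H G ρ (ι x) (ι y) (S (ι x) (ι y)) * n ^ (2 * e))
    bound-lifts x y p' heavy = begin
      m ^ e * n ^ rest  ≤⟨ *-mono-≤ (^-monoˡ-≤ e m≤κm') (^-monoˡ-≤ rest n≤κn₀) ⟩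
      (κ * m') ^ e * (κ * n₀) ^ rest  ≡⟨ cong₂ _*_ (^-distribʳ-* e κ m') (^-distribʳ-* rest κ n₀) ⟩
      κ ^ e * m' ^ e * (κ ^ rest * n₀ ^ rest)  ≡⟨ interchange (κ ^ e) (m' ^ e) (κ ^ rest) (n₀ ^ rest) ⟩
      κ ^ e * κ ^ rest * (m' ^ e * n₀ ^ rest)  ≤⟨ *-monoʳ-≤ (κ ^ e * κ ^ rest) heavy ⟩
      κ ^ e * κ ^ rest * (B * (q² x y * n₀ ^ (2 * e)))  ≡⟨ *-assoc (κ ^ e * κ ^ rest) B _ ⟨
      spread κ * (q² x y * n₀ ^ (2 * e))  ≤⟨ *-monoʳ-≤ (spread κ) (*-mono-≤ (q²≤ x y p') (^-monoˡ-≤ (2 * e) n₀≤n)) ⟩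
      spread κ * (extensions H G ρ (ι x) (ι y) (S (ι x) (ι y)) * n ^ (2 * e)) ∎

    some-heavy-edge : ∃[ u ] ∃[ v ] (P u v ≡ true ×
      m ^ e * n ^ rest ≤ spread κ * (extensions H G ρ u v (S u v) * n ^ (2 * e)))
    some-heavy-edge = lifted (heavy-edge G' E G'-edges (dense {n₀} {m'} n₀≤n m≤κm') m'>0)
      where
      E : Fin n₀ → Fin n₀ → Bool
      E x y = P' (ι x) (ι y)
      lifted : ∃[ x ] ∃[ y ] (E x y ≡ true × m' ^ e * n₀ ^ rest ≤ B * (q² x y * n₀ ^ (2 * e))) →
        ∃[ u ] ∃[ v ] (P u v ≡ true ×
          m ^ e * n ^ rest ≤ spread κ * (extensions H G ρ u v (S u v) * n ^ (2 * e)))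
      lifted (x , y , p' , heavy) = ι x , ι y , P'⇒P p' , bound-lifts x y p' heavy

  -- What goodness says once each edge has its own set to avoid: a quarter of the edges can never
  -- consist solely of edges with few extensions off `S u v`. It is used to show by contradiction
  -- that an exceptional class of edges is small.
  robust-edge : ∀ {n k} (G : Graph n) (P : Fin n → Fin n → Bool) (S : Fin n → Fin n → Fin k → Fin n) →
    (∀ {n' m'} → n' ≤ n → edges G ≤ dilution k * m' → Dense n' m') → 0 < edges G →
    (∀ u v → P u v ≡ true → adj G u v ≡ true × toℕ u < toℕ v) →
    (∀ u v → P u v ≡ true → ∀ j → S u v j ≢ u × S u v j ≢ v) →
    edges G ≤ 4 * sum₂ (λ u v → ⟦ P u v ⟧) →
    ∃[ u ] ∃[ v ] (P u v ≡ true ×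
      edges G ^ e * n ^ rest ≤ spread (dilution k) * (extensions H G ρ u v (S u v) * n ^ (2 * e)))
  robust-edge {n} {k} G P S dense pos P-edge avoid large = from-colouring (good-colouring P S avoid)
    where
    from-colouring : ∃[ c ] (sum₂ (λ u v → ⟦ P u v ⟧) * n ≤ density k * (sum₂ (λ u v → ⟦ kept P S c u v ⟧) * sum (λ x → ⟦ c x ⟧))) →
      ∃[ u ] ∃[ v ] (P u v ≡ true ×
        edges G ^ e * n ^ rest ≤ spread (dilution k) * (extensions H G ρ u v (S u v) * n ^ (2 * e)))
    from-colouring (c , coloured) =
      Diluted.some-heavy-edge {d = density k} G P S c (enumerate c) coloured (dilution k) refl dense pos P-edge large

-- Gluings

bool-ext : ∀ {b c} → (b ≡ true → c ≡ true) → (c ≡ true → b ≡ true) → b ≡ c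
bool-ext {false} {false} h k = refl
bool-ext {false} {true}  h k = k refl
bool-ext {true}  {c}     h k = sym (h refl)

fill-injective : ∀ {A : Set} {w} {p q : A} {h : Fin w → A} → p ≢ q → (∀ j → h j ≢ p) → (∀ j → h j ≢ q) →
  (∀ i j → h i ≡ h j → i ≡ j) → ∀ s t → fill p q h s ≡ fill p q h t → s ≡ t
fill-injective p≢q hp hq inj left     left     e = refl
fill-injective p≢q hp hq inj left     right    e = ⊥-elim (p≢q e)
fill-injective p≢q hp hq inj left     (free j) e = ⊥-elim (hp j (sym e))
fill-injective p≢q hp hq inj right    left     e = ⊥-elim (p≢q (sym e))
fill-injective p≢q hp hq inj right    right    e = refl
fill-injective p≢q hp hq inj right    (free j) e = ⊥-elim (hq j (sym e))
fill-injective p≢q hp hq inj (free i) left     e = ⊥-elim (hp i e)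
fill-injective p≢q hp hq inj (free i) right    e = ⊥-elim (hq i e)
fill-injective p≢q hp hq inj (free i) (free j) e = cong free (inj i j e)

orient-free : ∀ {A : Set} {w} o (x y : A) (g : Fin w → A) j → orient o (λ p q → fill p q g (free j)) x y ≡ g j
orient-free false x y g j = refl
orient-free true  x y g j = refl

module Glue {v₁ v₂ : ℕ} (H₁ : Graph v₁) (H₂ : Graph v₂) {a₁ b₁ : Fin v₁} {a₂ b₂ : Fin v₂}
            (ρ₁ : Rooting a₁ b₁) (ρ₂ : Rooting a₂ b₂) where
  open Rooting ρ₁ using () renaming (rest to w₁; slot to slot₁; unslot to unslot₁; slot-unslot to slot-unslot₁)
  open Rooting ρ₂ using () renaming (rest to w₂; slot to slot₂; unslot to unslot₂; slot-unslot to slot-unslot₂)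

  -- Vertices 0 and 1 are the ends of the identified edge; then come the other vertices of `H₁`,
  -- then those of `H₂`.
  order : ℕ
  order = 2 + (w₁ + w₂)

  free₁ : Fin w₁ → Fin order
  free₁ j = suc (suc (j Fin.↑ˡ w₂))

  free₂ : Fin w₂ → Fin order
  free₂ j = suc (suc (w₁ Fin.↑ʳ j))

  e₁ : Slot w₁ → Fin order
  e₁ = fill zero (suc zero) free₁

  e₂ : Bool → Slot w₂ → Fin order
  e₂ o s = orient o (λ x y → fill x y free₂ s) zero (suc zero)

  e₁-injective : ∀ s t → e₁ s ≡ e₁ t → s ≡ t
  e₁-injective = fill-injective (λ ()) (λ _ ()) (λ _ ())
    (λ i j e → Finₚ.↑ˡ-injective w₂ i j (Finₚ.suc-injective (Finₚ.suc-injective e)))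

  free₂-injective : ∀ i j → free₂ i ≡ free₂ j → i ≡ j
  free₂-injective i j e = Finₚ.↑ʳ-injective w₁ i j (Finₚ.suc-injective (Finₚ.suc-injective e))

  e₂-injective : ∀ o s t → e₂ o s ≡ e₂ o t → s ≡ t
  e₂-injective false = fill-injective (λ ()) (λ _ ()) (λ _ ()) free₂-injective
  e₂-injective true  = fill-injective (λ ()) (λ _ ()) (λ _ ()) free₂-injective

  free₁≢free₂ : ∀ i j → free₁ i ≢ free₂ j
  free₁≢free₂ i j e with trans (sym (Finₚ.splitAt-↑ˡ w₁ i w₂))
    (trans (cong (Fin.splitAt w₁) (Finₚ.suc-injective (Finₚ.suc-injective e))) (Finₚ.splitAt-↑ʳ w₁ w₂ j))
  ... | ()

  free₁∉e₂ : ∀ o i t → free₁ i ≢ e₂ o t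
  free₁∉e₂ false i (free j) e = free₁≢free₂ i j e
  free₁∉e₂ true  i (free j) e = free₁≢free₂ i j e
  free₁∉e₂ false i left  ()
  free₁∉e₂ false i right ()
  free₁∉e₂ true  i left  ()
  free₁∉e₂ true  i right ()

  -- The ends of the root edge lie in both graphs, whichever way they are matched; only free
  -- vertices are private to one side.
  shared₁ : ∀ o s → (∃[ k ] s ≡ free k) ⊎ (∃[ t ] e₂ o t ≡ e₁ s)
  shared₁ _     (free k) = inj₁ (k , refl)
  shared₁ false left     = inj₂ (left , refl)
  shared₁ false right    = inj₂ (right , refl)
  shared₁ true  left     = inj₂ (right , refl)
  shared₁ true  right    = inj₂ (left , refl)

  shared₂ : ∀ o t → (∃[ k ] t ≡ free k) ⊎ (∃[ s ] e₁ s ≡ e₂ o t)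
  shared₂ _     (free k) = inj₁ (k , refl)
  shared₂ false left     = inj₂ (left , refl)
  shared₂ false right    = inj₂ (right , refl)
  shared₂ true  left     = inj₂ (right , refl)
  shared₂ true  right    = inj₂ (left , refl)

  module Oriented (o : Bool) where
    f₁ : Fin v₁ → Fin order
    f₁ i = e₁ (slot₁ i)

    f₂ : Fin v₂ → Fin order
    f₂ i = e₂ o (slot₂ i)

    f₁-injective : ∀ i j → f₁ i ≡ f₁ j → i ≡ j
    f₁-injective i j e = slot-injective ρ₁ (e₁-injective _ _ e)

    f₂-injective : ∀ i j → f₂ i ≡ f₂ j → i ≡ j
    f₂-injective i j e = slot-injective ρ₂ (e₂-injective o _ _ e)

    e₁-image : ∀ s → f₁ (unslot₁ s) ≡ e₁ s
    e₁-image s = cong e₁ (slot-unslot₁ s)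

    e₂-image : ∀ s → f₂ (unslot₂ s) ≡ e₂ o s
    e₂-image s = cong (e₂ o) (slot-unslot₂ s)

    covered : ∀ x → (∃[ i ] f₁ i ≡ x) ⊎ (∃[ j ] f₂ j ≡ x)
    covered zero       = inj₁ (unslot₁ left , e₁-image left)
    covered (suc zero) = inj₁ (unslot₁ right , e₁-image right)
    covered (suc (suc z)) with Fin.splitAt w₁ z in eq
    ... | inj₁ k = inj₁ (unslot₁ (free k) , trans (e₁-image (free k)) (cong (λ z → Fin.suc (Fin.suc z)) (Finₚ.splitAt⁻¹-↑ˡ eq)))
    ... | inj₂ k = inj₂ (unslot₂ (free k) , trans (e₂-image (free k)) (trans (orient-free o zero (suc zero) free₂ k) (cong (λ z → Fin.suc (Fin.suc z)) (Finₚ.splitAt⁻¹-↑ʳ eq))))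

    Edge : Fin order → Fin order → Set
    Edge x y = (∃[ i ] ∃[ j ] (f₁ i ≡ x × f₁ j ≡ y × adj H₁ i j ≡ true)) ⊎
               (∃[ i ] ∃[ j ] (f₂ i ≡ x × f₂ j ≡ y × adj H₂ i j ≡ true))

    edge? : ∀ x y → Dec (Edge x y)
    edge? x y =
      Finₚ.any? (λ i → Finₚ.any? (λ j → (f₁ i Fin.≟ x) ×-dec (f₁ j Fin.≟ y) ×-dec (adj H₁ i j Bool.≟ true))) ⊎-dec
      Finₚ.any? (λ i → Finₚ.any? (λ j → (f₂ i Fin.≟ x) ×-dec (f₂ j Fin.≟ y) ×-dec (adj H₂ i j Bool.≟ true)))

    Edge-sym : ∀ {x y} → Edge x y → Edge y x
    Edge-sym (inj₁ (i , j , p , q , h)) = inj₁ (j , i , q , p , trans (Graph.sym H₁ j i) h)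
    Edge-sym (inj₂ (i , j , p , q , h)) = inj₂ (j , i , q , p , trans (Graph.sym H₂ j i) h)

    Edge-irrefl : ∀ {x} → ¬ Edge x x
    Edge-irrefl (inj₁ (i , j , p , q , h)) with refl ← f₁-injective i j (trans p (sym q)) = true≢false h (irrefl H₁ i)
    Edge-irrefl (inj₂ (i , j , p , q , h)) with refl ← f₂-injective i j (trans p (sym q)) = true≢false h (irrefl H₂ i)

    glued : Graph order
    glued = record
      { adj    = λ x y → ⌊ edge? x y ⌋
      ; sym    = λ x y → bool-ext (λ h → ⌊⌋-true (edge? y x) (Edge-sym (true-⌊⌋ (edge? x y) h)))
                                  (λ h → ⌊⌋-true (edge? x y) (Edge-sym (true-⌊⌋ (edge? y x) h)))
      ; irrefl = λ x → bool-ext (λ h → ⊥-elim (Edge-irrefl (true-⌊⌋ (edge? x x) h))) (λ ()) }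

    isGluing : IsGluing H₁ H₂ a₁ b₁ a₂ b₂ glued
    isGluing = record
      { f₁ = f₁ ; f₂ = f₂ ; inj₁ = f₁-injective ; inj₂ = f₂-injective
      ; identify = identify ; meet = meet ; cover = covered
      ; edgeSet = λ x y → mk⇔ (true-⌊⌋ (edge? x y)) (⌊⌋-true (edge? x y)) }
      where
      identify : (f₁ a₁ ≡ f₂ a₂ × f₁ b₁ ≡ f₂ b₂) ⊎ (f₁ a₁ ≡ f₂ b₂ × f₁ b₁ ≡ f₂ a₂)
      identify rewrite slot-a ρ₁ | slot-b ρ₁ | slot-a ρ₂ | slot-b ρ₂ = ends o
        where
        ends : ∀ o → (zero ≡ e₂ o left × suc zero ≡ e₂ o right) ⊎ (zero ≡ e₂ o right × suc zero ≡ e₂ o left)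
        ends false = inj₁ (refl , refl)
        ends true  = inj₂ (refl , refl)
      meet : ∀ i j → f₁ i ≡ f₂ j → i ≡ a₁ ⊎ i ≡ b₁
      meet i j e with slot₁ i in eq
      ... | left   = inj₁ (slot-injective ρ₁ (trans eq (sym (slot-a ρ₁))))
      ... | right  = inj₂ (slot-injective ρ₁ (trans eq (sym (slot-b ρ₁))))
      ... | free k = ⊥-elim (free₁∉e₂ o k (slot₂ j) e)

    module _ {n : ℕ} (G : Graph n) where
      join : Fin n → Fin n → (Fin w₁ → Fin n) → (Fin w₂ → Fin n) → Fin order → Fin n
      join x y g₁ g₂ = consF x (consF y (g₁ Vec.++ g₂))

      join-copy : ∀ x y g₁ g₂ → isCopy H₂ G (Rooting.place ρ₂ o x y g₂) ≡ true →
        extends H₁ G ρ₁ false x y g₂ g₁ ≡ true → isCopy glued G (join x y g₁ g₂) ≡ true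
      join-copy x y g₁ g₂ c₂ c₁ = isCopy-complete glued G h (h-injective , hom)
        where
        h = join x y g₁ g₂
        copy₁ = isCopy-sound H₁ G _ (proj₁ (∧-true {isCopy H₁ G (Rooting.place ρ₁ false x y g₁)} c₁))
        copy₂ = isCopy-sound H₂ G _ c₂
        apart = disjoint-sound g₁ g₂ (proj₂ (∧-true {isCopy H₁ G (Rooting.place ρ₁ false x y g₁)} c₁))

        on₁ : ∀ i → h (f₁ i) ≡ Rooting.place ρ₁ false x y g₁ i
        on₁ i = trans (place-natural ρ₁ h false zero (suc zero) free₁ i)
                      (place-cong ρ₁ false x y (Vecₚ.lookup-++ˡ g₁ g₂) i)

        on₂ : ∀ i → h (f₂ i) ≡ Rooting.place ρ₂ o x y g₂ i
        on₂ i = trans (place-natural ρ₂ h o zero (suc zero) free₂ i)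
                      (place-cong ρ₂ o x y (Vecₚ.lookup-++ʳ g₁ g₂) i)

        h-injective₁ : ∀ i j → h (f₁ i) ≡ h (f₁ j) → f₁ i ≡ f₁ j
        h-injective₁ i j e = cong f₁ (proj₁ copy₁ i j (trans (sym (on₁ i)) (trans e (on₁ j))))

        h-injective₂ : ∀ i j → h (f₂ i) ≡ h (f₂ j) → f₂ i ≡ f₂ j
        h-injective₂ i j e = cong f₂ (proj₁ copy₂ i j (trans (sym (on₂ i)) (trans e (on₂ j))))

        -- If one of the two vertices is an end, it also lies in the other graph, whose copy is
        -- injective. If both are free, disjointness of `g₁` and `g₂` applies.
        h-injective₁₂ : ∀ i j → h (f₁ i) ≡ h (f₂ j) → f₁ i ≡ f₂ j
        h-injective₁₂ i j e with shared₁ o (slot₁ i) | shared₂ o (slot₂ j)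
        ... | inj₂ (t , q) | _ = trans (sym p)
          (h-injective₂ (unslot₂ t) j (trans (cong h p) e))
          where
          p : f₂ (unslot₂ t) ≡ f₁ i
          p = trans (e₂-image t) q
        ... | inj₁ _ | inj₂ (s , q) = trans (h-injective₁ i (unslot₁ s) (trans e (sym (cong h p)))) p
          where
          p : f₁ (unslot₁ s) ≡ f₂ j
          p = trans (e₁-image s) q
        ... | inj₁ (k , p) | inj₁ (l , q) = ⊥-elim (apart k l
          (trans (sym (trans (on₁ i) (cong (fill x y g₁) p)))
            (trans e (trans (on₂ j) (trans (cong (λ t → orient o (λ x y → fill x y g₂ t) x y) q) (orient-free o x y g₂ l))))))

        h-injective : ∀ p q → h p ≡ h q → p ≡ q
        h-injective p q e with covered p | covered q
        ... | inj₁ (i , refl) | inj₁ (j , refl) = h-injective₁ i j e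
        ... | inj₁ (i , refl) | inj₂ (j , refl) = h-injective₁₂ i j e
        ... | inj₂ (i , refl) | inj₁ (j , refl) = sym (h-injective₁₂ j i (sym e))
        ... | inj₂ (i , refl) | inj₂ (j , refl) = h-injective₂ i j e

        hom : ∀ p q → adj glued p q ≡ true → adj G (h p) (h q) ≡ true
        hom p q e with true-⌊⌋ (edge? p q) e
        ... | inj₁ (i , j , refl , refl , a) = subst₂ (λ x y → adj G x y ≡ true) (sym (on₁ i)) (sym (on₁ j)) (proj₂ copy₁ i j a)
        ... | inj₂ (i , j , refl , refl , a) = subst₂ (λ x y → adj G x y ≡ true) (sym (on₂ i)) (sym (on₂ j)) (proj₂ copy₂ i j a)

      -- `H₁` stays unswapped since the gluing depends only on the relative orientation `o`; the
      -- swapped case is `pairings y x`.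
      pairings : Fin n → Fin n → ℕ
      pairings x y = ∑M w₂ (λ g₂ → ⟦ isCopy H₂ G (Rooting.place ρ₂ o x y g₂) ⟧ *
                                   ∑M w₁ (λ g₁ → ⟦ extends H₁ G ρ₁ false x y g₂ g₁ ⟧))

      -- Every map from the glued vertex set is `join x y g₁ g₂` for exactly one choice of the four
      -- parts, so distinct pairs yield distinct copies.
      pairings≤copies : sum₂ pairings ≤ copies glued G
      pairings≤copies = begin
        sum₂ pairings  ≤⟨ sum₂-mono (λ x y → ∑M-mono w₂ (step x y)) ⟩
        sum₂ (λ x y → ∑M w₂ (λ g₂ → ∑M w₁ (λ g₁ → F (join x y g₁ g₂))))
          ≡⟨ ∑M-sum₂-comm w₂ (λ g₂ x y → ∑M w₁ (λ g₁ → F (join x y g₁ g₂))) ⟨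
        ∑M w₂ (λ g₂ → sum₂ (λ x y → ∑M w₁ (λ g₁ → F (join x y g₁ g₂))))
          ≡⟨ ∑M-cong w₂ (λ g₂ → ∑M-sum₂-comm w₁ (λ g₁ x y → F (join x y g₁ g₂))) ⟨
        ∑M w₂ (λ g₂ → ∑M w₁ (λ g₁ → sum₂ (λ x y → F (join x y g₁ g₂))))
          ≡⟨ ∑M-++ w₁ w₂ (λ f → sum₂ (λ x y → F (consF x (consF y f))))
               (λ h → sum₂-cong (λ x y → isCopy-ext glued G (consF-cong x (consF-cong y h)))) ⟨
        ∑M (w₁ + w₂) (λ f → sum₂ (λ x y → F (consF x (consF y f))))
          ≡⟨ ∑M-cong (w₁ + w₂) (λ f → ∑-comm (λ x y → F (consF x (consF y f)))) ⟩
        ∑M order F  ≡⟨ copies≡∑M glued G ⟨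
        copies glued G ∎
        where
        open ≤-Reasoning
        F : (Fin order → Fin n) → ℕ
        F f = ⟦ isCopy glued G f ⟧
        step : ∀ x y g₂ → ⟦ isCopy H₂ G (Rooting.place ρ₂ o x y g₂) ⟧ * ∑M w₁ (λ g₁ → ⟦ extends H₁ G ρ₁ false x y g₂ g₁ ⟧) ≤
          ∑M w₁ (λ g₁ → F (join x y g₁ g₂))
        step x y g₂ with isCopy H₂ G (Rooting.place ρ₂ o x y g₂) in c₂
        ... | false = z≤n
        ... | true  = ≤-trans (≤-reflexive (*-identityˡ _)) (∑M-mono w₁ (λ g₁ → ⟦⟧-mono (join-copy x y g₁ g₂ c₂)))

-- Counting pairs of disjoint extensions

edge⇒edges>0 : ∀ {v} (H : Graph v) {a b} → adj H a b ≡ true → 0 < edges H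
edge⇒edges>0 H {a} {b} ab = by-order (<-cmp (toℕ a) (toℕ b))
  where
  counted : ∀ a b → adj H a b ≡ true → toℕ a < toℕ b → 0 < edges H
  counted a b ab lt = begin
    1  ≡⟨ cong ⟦_⟧ (true-∧ ab (⌊⌋-true (toℕ a <? toℕ b) lt)) ⟨
    ⟦ adj H a b ∧ a <ᵇᶠ b ⟧  ≤⟨ term≤sum (λ v → ⟦ adj H a v ∧ a <ᵇᶠ v ⟧) b ⟩
    sum (λ v → ⟦ adj H a v ∧ a <ᵇᶠ v ⟧)  ≤⟨ term≤sum (λ u → sum (λ v → ⟦ adj H u v ∧ u <ᵇᶠ v ⟧)) a ⟩
    sum₂ (λ u v → ⟦ adj H u v ∧ u <ᵇᶠ v ⟧)  ≡⟨ edges≡sum₂ H ⟨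
    edges H ∎
    where open ≤-Reasoning
  by-order : Tri (toℕ a < toℕ b) (toℕ a ≡ toℕ b) (toℕ b < toℕ a) → 0 < edges H
  by-order (tri< lt _ _) = counted a b ab lt
  by-order (tri≈ _ eq _) = ⊥-elim (true≢false ab (subst (λ z → adj H a z ≡ false) (Finₚ.toℕ-injective eq) (irrefl H a)))
  by-order (tri> _ _ gt) = counted b a (trans (Graph.sym H b a) ab) gt

adj⇒≢ : ∀ {v} (H : Graph v) {a b} → adj H a b ≡ true → a ≢ b
adj⇒≢ H {a} ab refl = true≢false ab (irrefl H a)

false-⌊⌋ : ∀ {P : Set} (d : Dec P) → ⌊ d ⌋ ≡ false → ¬ P
false-⌊⌋ (no ¬p) _ = ¬p

-- Otherwise three parts, each below `m/4`, would cover all of `m`.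
majority : ∀ m p b f → m ≤ p + b + f → 4 * p < m → 4 * b < m → m ≤ 4 * f
majority m p b f total p< b< = ≮⇒≥ (λ f< → <-irrefl refl (begin-strict
  4 * m                  ≤⟨ *-monoʳ-≤ 4 total ⟩
  4 * (p + b + f)        ≡⟨ distribute p b f ⟩
  4 * p + 4 * b + 4 * f  <⟨ +-mono-< (+-mono-< p< b<) f< ⟩
  m + m + m              ≤⟨ m≤n+m (m + m + m) m ⟩
  m + (m + m + m)        ≡⟨ four m ⟩
  4 * m                  ∎))
  where
  open ≤-Reasoning
  distribute : ∀ p b f → 4 * (p + b + f) ≡ 4 * p + 4 * b + 4 * f
  distribute = solve-∀
  four : ∀ m → m + (m + m + m) ≡ 4 * m
  four = solve-∀

module Counting
  {v₁ v₂ : ℕ} (H₁ : Graph v₁) (H₂ : Graph v₂) {a₁ b₁ : Fin v₁} {a₂ b₂ : Fin v₂}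
  (ρ₁ : Rooting a₁ b₁) (ρ₂ : Rooting a₂ b₂)
  {n : ℕ} (G : Graph n) (e₁ e₂ K₁ K₂ : ℕ)
  (robust₁ : (P : Fin n → Fin n → Bool) (S : Fin n → Fin n → Fin (Rooting.rest ρ₂) → Fin n) →
    (∀ u v → P u v ≡ true → adj G u v ≡ true × toℕ u < toℕ v) →
    (∀ u v → P u v ≡ true → ∀ j → S u v j ≢ u × S u v j ≢ v) →
    edges G ≤ 4 * sum₂ (λ u v → ⟦ P u v ⟧) →
    ∃[ u ] ∃[ v ] (P u v ≡ true ×
      edges G ^ e₁ * n ^ Rooting.rest ρ₁ ≤ K₁ * (extensions H₁ G ρ₁ u v (S u v) * n ^ (2 * e₁))))
  (robust₂ : (P : Fin n → Fin n → Bool) (S : Fin n → Fin n → Fin 0 → Fin n) →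
    (∀ u v → P u v ≡ true → adj G u v ≡ true × toℕ u < toℕ v) →
    (∀ u v → P u v ≡ true → ∀ j → S u v j ≢ u × S u v j ≢ v) →
    edges G ≤ 4 * sum₂ (λ u v → ⟦ P u v ⟧) →
    ∃[ u ] ∃[ v ] (P u v ≡ true ×
      edges G ^ e₂ * n ^ Rooting.rest ρ₂ ≤ K₂ * (extensions H₂ G ρ₂ u v (S u v) * n ^ (2 * e₂))))
  where
  open Rooting ρ₁ using () renaming (rest to w₁)
  open Rooting ρ₂ using () renaming (rest to w₂; place to place₂; unslot to unslot₂; slot to slot₂; slot-unslot to slot-unslot₂)
  open Glue H₁ H₂ ρ₁ ρ₂ using (module Oriented)
  open ≤-Reasoning

  -- With `p = m/n²`, the ratio of `X₁` to `N₁` is `p^e₁ n^w₁`: up to a constant, the number of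
  -- copies of `H₁` that an average edge must carry. Likewise for `H₂`.
  m X₁ X₂ N₁ N₂ : ℕ
  m  = edges G
  X₁ = m ^ e₁ * n ^ w₁
  X₂ = m ^ e₂ * n ^ w₂
  N₁ = n ^ (2 * e₁)
  N₂ = n ^ (2 * e₂)

  none : Fin n → Fin n → Fin 0 → Fin n
  none u v ()

  ext₁ : Fin n → Fin n → (Fin w₂ → Fin n) → ℕ
  ext₁ u v s = extensions H₁ G ρ₁ u v s

  copy₂ : Bool → Fin n → Fin n → (Fin w₂ → Fin n) → Bool
  copy₂ o u v g = isCopy H₂ G (place₂ o u v g)

  multiplicity : Fin n → Fin n → (Fin w₂ → Fin n) → ℕ
  multiplicity u v g = ⟦ copy₂ false u v g ⟧ + ⟦ copy₂ true u v g ⟧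

  ext₂ D : Fin n → Fin n → ℕ
  ext₂ u v = ∑M w₂ (multiplicity u v)
  D u v = ∑M w₂ (λ g → multiplicity u v g * ext₁ u v g)

  -- `Good` says that a copy of `H₂` at `uv` is, on average, disjoint from at least `X₁ / (K₁ * N₁)`
  -- copies of `H₁` there. `Obstruction` below is a single choice of free vertices that falls short
  -- of that average.
  Rich Good : Fin n → Fin n → Set
  Rich u v = X₂ ≤ K₂ * (extensions H₂ G ρ₂ u v (none u v) * N₂)
  Good u v = X₁ * ext₂ u v ≤ K₁ * (D u v * N₁)

  Obstruction : Fin n → Fin n → Set
  Obstruction u v = ∃[ g ] ((∀ j → g j ≢ u × g j ≢ v) × ¬ (X₁ ≤ K₁ * (ext₁ u v g * N₁)))

  copy₂-avoids : ∀ o u v g → copy₂ o u v g ≡ true → ∀ j → g j ≢ u × g j ≢ v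
  copy₂-avoids o u v g c j = ends o (proj₁ (isCopy-sound H₂ G (place₂ o u v g) c))
    where
    clash : ∀ {s t} → s ≢ t → unslot₂ s ≢ unslot₂ t
    clash s≢t e = s≢t (trans (sym (slot-unslot₂ _)) (trans (cong slot₂ e) (slot-unslot₂ _)))
    at : ∀ x y s → fill x y g (slot₂ (unslot₂ s)) ≡ fill x y g s
    at x y s = cong (fill x y g) (slot-unslot₂ s)
    ends : ∀ o → (∀ i k → place₂ o u v g i ≡ place₂ o u v g k → i ≡ k) → g j ≢ u × g j ≢ v
    ends false inj = (λ e → clash {free j} {left}  (λ ()) (inj _ _ (trans (at u v (free j)) (trans e (sym (at u v left))))))
                   , (λ e → clash {free j} {right} (λ ()) (inj _ _ (trans (at u v (free j)) (trans e (sym (at u v right))))))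
    ends true  inj = (λ e → clash {free j} {right} (λ ()) (inj _ _ (trans (at v u (free j)) (trans e (sym (at v u right))))))
                   , (λ e → clash {free j} {left}  (λ ()) (inj _ _ (trans (at v u (free j)) (trans e (sym (at v u left))))))

  -- Pigeonhole over the copies of H₂ at uv: if few pairs are disjoint, some copy g is disjoint from few copies of H₁.
  classify : ∀ u v → Good u v ⊎ Obstruction u v
  classify u v = decide (X₁ * ext₂ u v ≤? K₁ * (D u v * N₁))
    where
    L R : (Fin w₂ → Fin n) → ℕ
    L g = K₁ * (multiplicity u v g * ext₁ u v g * N₁)
    R g = X₁ * multiplicity u v g

    obstruct : ∀ g → L g < R g → Obstruction u v
    obstruct g lt = g , avoids-uv (copy₂ false u v g) (copy₂ true u v g) refl refl , not-heavy
      where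
      not-heavy : ¬ (X₁ ≤ K₁ * (ext₁ u v g * N₁))
      not-heavy heavy = <⇒≱ lt (begin
        X₁ * multiplicity u v g                      ≤⟨ *-monoˡ-≤ (multiplicity u v g) heavy ⟩
        K₁ * (ext₁ u v g * N₁) * multiplicity u v g  ≡⟨ rearrange K₁ (ext₁ u v g) N₁ (multiplicity u v g) ⟩
        L g                                          ∎)
        where
        rearrange : ∀ k x n s → k * (x * n) * s ≡ k * (s * x * n)
        rearrange = solve-∀
      avoids-uv : ∀ p q → copy₂ false u v g ≡ p → copy₂ true u v g ≡ q → ∀ j → g j ≢ u × g j ≢ v
      avoids-uv true  _     cf ct = copy₂-avoids false u v g cf
      avoids-uv false true  cf ct = copy₂-avoids true u v g ct
      -- A strict inequality is impossible when `g` completes no copy of `H₂`, so the obstructing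
      -- `g` does belong to a copy and therefore misses `u` and `v`.
      avoids-uv false false cf ct = ⊥-elim (n≮0 (subst (L g <_)
        (trans (cong₂ (λ p q → X₁ * (⟦ p ⟧ + ⟦ q ⟧)) cf ct) (*-zeroʳ X₁)) lt))

    decide : Dec (Good u v) → Good u v ⊎ Obstruction u v
    decide (yes good) = inj₁ good
    decide (no ¬good) = inj₂ (let g , lt = ∑M-exists-< w₂ below in obstruct g lt)
      where
      below : ∑M w₂ L < ∑M w₂ R
      below = begin-strict
        ∑M w₂ L            ≡⟨ ∑M-*ˡ w₂ K₁ (λ g → multiplicity u v g * ext₁ u v g * N₁) ⟩
        K₁ * ∑M w₂ (λ g → multiplicity u v g * ext₁ u v g * N₁)
                           ≡⟨ cong (K₁ *_) (∑M-*ʳ w₂ N₁ (λ g → multiplicity u v g * ext₁ u v g)) ⟩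
        K₁ * (D u v * N₁)  <⟨ ≰⇒> ¬good ⟩
        X₁ * ext₂ u v      ≡⟨ ∑M-*ˡ w₂ X₁ (multiplicity u v) ⟨
        ∑M w₂ R            ∎

  E rich good poor bad fine : Fin n → Fin n → Bool
  E u v    = adj G u v ∧ u <ᵇᶠ v
  rich u v = ⌊ X₂ ≤? K₂ * (extensions H₂ G ρ₂ u v (none u v) * N₂) ⌋
  -- Read off from `classify` so that an edge failing it comes with the very obstruction that
  -- `obstacle` returns.
  good u v = is-good (classify u v)
    where
    is-good : Good u v ⊎ Obstruction u v → Bool
    is-good (inj₁ _) = true
    is-good (inj₂ _) = false
  poor u v = E u v ∧ not (rich u v)
  bad u v  = E u v ∧ not (good u v)
  fine u v = E u v ∧ (rich u v ∧ good u v)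

  E-sound : ∀ u v → E u v ≡ true → adj G u v ≡ true × toℕ u < toℕ v
  E-sound u v h = proj₁ (∧-true {adj G u v} h) , true-⌊⌋ (toℕ u <? toℕ v) (proj₂ (∧-true {adj G u v} h))

  -- The constant map to `u` is a filler for the first outcome: `robust₁` asks the sets to avoid the
  -- ends only on the chosen edges, here the `bad` ones.
  obstacle : Fin n → Fin n → Fin w₂ → Fin n
  obstacle u v = pick (classify u v)
    where
    pick : Good u v ⊎ Obstruction u v → Fin w₂ → Fin n
    pick (inj₁ _)       _ = u
    pick (inj₂ (g , _)) = g

  good-sound : ∀ u v → good u v ≡ true → Good u v
  good-sound u v h with classify u v
  ... | inj₁ g = g

  bad-obstructed : ∀ u v → good u v ≡ false →
    (∀ j → obstacle u v j ≢ u × obstacle u v j ≢ v) × ¬ (X₁ ≤ K₁ * (ext₁ u v (obstacle u v) * N₁))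
  bad-obstructed u v h with classify u v
  ... | inj₂ (g , obstructs) = obstructs

  -- Otherwise `robust₂`, with nothing to avoid, would find a rich edge among the poor ones. In the
  -- same way a large bad class would contain an edge whose obstacle is no obstruction.
  few-poor : 4 * sum₂ (λ u v → ⟦ poor u v ⟧) < m
  few-poor = ≰⇒> (λ large → contradict (robust₂ poor none
    (λ u v h → E-sound u v (proj₁ (∧-true {E u v} h))) (λ _ _ _ ()) large))
    where
    contradict : ∃[ u ] ∃[ v ] (poor u v ≡ true × Rich u v) → ⊥
    contradict (u , v , h , heavy) =
      false-⌊⌋ (X₂ ≤? K₂ * (extensions H₂ G ρ₂ u v (none u v) * N₂)) (true-not (proj₂ (∧-true {E u v} h))) heavy

  few-bad : 4 * sum₂ (λ u v → ⟦ bad u v ⟧) < m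
  few-bad = ≰⇒> (λ large → contradict (robust₁ bad obstacle
    (λ u v h → E-sound u v (proj₁ (∧-true {E u v} h))) (λ u v h → proj₁ (obstructed u v h)) large))
    where
    obstructed = λ u v (h : bad u v ≡ true) → bad-obstructed u v (true-not (proj₂ (∧-true {E u v} h)))
    contradict : ∃[ u ] ∃[ v ] (bad u v ≡ true × X₁ ≤ K₁ * (ext₁ u v (obstacle u v) * N₁)) → ⊥
    contradict (u , v , h , heavy) = proj₂ (obstructed u v h) heavy

  many-fine : m ≤ 4 * sum₂ (λ u v → ⟦ fine u v ⟧)
  many-fine = majority m (sum₂ (λ u v → ⟦ poor u v ⟧)) (sum₂ (λ u v → ⟦ bad u v ⟧)) (sum₂ (λ u v → ⟦ fine u v ⟧))
    total few-poor few-bad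
    where
    total : m ≤ sum₂ (λ u v → ⟦ poor u v ⟧) + sum₂ (λ u v → ⟦ bad u v ⟧) + sum₂ (λ u v → ⟦ fine u v ⟧)
    total = begin
      m  ≡⟨ edges≡sum₂ G ⟩
      sum₂ (λ u v → ⟦ E u v ⟧)  ≤⟨ sum₂-mono (λ u v → cases (E u v) (rich u v) (good u v)) ⟩
      sum₂ (λ u v → ⟦ poor u v ⟧ + ⟦ bad u v ⟧ + ⟦ fine u v ⟧)
        ≡⟨ sum₂-distrib-+ (λ u v → ⟦ poor u v ⟧ + ⟦ bad u v ⟧) (λ u v → ⟦ fine u v ⟧) ⟩
      sum₂ (λ u v → ⟦ poor u v ⟧ + ⟦ bad u v ⟧) + sum₂ (λ u v → ⟦ fine u v ⟧)
        ≡⟨ cong (_+ sum₂ (λ u v → ⟦ fine u v ⟧)) (sum₂-distrib-+ (λ u v → ⟦ poor u v ⟧) (λ u v → ⟦ bad u v ⟧)) ⟩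
      sum₂ (λ u v → ⟦ poor u v ⟧) + sum₂ (λ u v → ⟦ bad u v ⟧) + sum₂ (λ u v → ⟦ fine u v ⟧) ∎
      where
      cases : ∀ p r g → ⟦ p ⟧ ≤ ⟦ p ∧ not r ⟧ + ⟦ p ∧ not g ⟧ + ⟦ p ∧ (r ∧ g) ⟧
      cases false _     _     = z≤n
      cases true  false _     = s≤s z≤n
      cases true  true  false = s≤s z≤n
      cases true  true  true  = s≤s z≤n

  -- Richness bounds `X₂` by the copies of `H₂` at `uv`, and goodness turns `X₁` times that number
  -- into disjoint pairs.
  fine-product : ∀ u v → fine u v ≡ true → X₁ * X₂ ≤ K₁ * K₂ * (N₁ * N₂) * D u v
  fine-product u v h = begin
    X₁ * X₂  ≤⟨ *-monoʳ-≤ X₁ (≤-trans is-rich (*-monoʳ-≤ K₂ (*-monoˡ-≤ N₂ ext₂≤))) ⟩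
    X₁ * (K₂ * (ext₂ u v * N₂))  ≡⟨ pull X₁ K₂ (ext₂ u v) N₂ ⟩
    K₂ * N₂ * (X₁ * ext₂ u v)  ≤⟨ *-monoʳ-≤ (K₂ * N₂) is-good ⟩
    K₂ * N₂ * (K₁ * (D u v * N₁))  ≡⟨ collect K₂ N₂ K₁ (D u v) N₁ ⟩
    K₁ * K₂ * (N₁ * N₂) * D u v ∎
    where
    rich∧good = ∧-true {rich u v} (proj₂ (∧-true {E u v} h))
    is-rich : Rich u v
    is-rich = true-⌊⌋ (X₂ ≤? K₂ * (extensions H₂ G ρ₂ u v (none u v) * N₂)) (proj₁ rich∧good)
    is-good : Good u v
    is-good = good-sound u v (proj₂ rich∧good)
    ext₂≤ : extensions H₂ G ρ₂ u v (none u v) ≤ ext₂ u v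
    ext₂≤ = ∑M-mono w₂ (λ g → +-mono-≤ (⟦⟧-mono (λ h → proj₁ (∧-true {copy₂ false u v g} h)))
                                       (⟦⟧-mono (λ h → proj₁ (∧-true {copy₂ true u v g} h))))
    pull : ∀ x k e n → x * (k * (e * n)) ≡ k * n * (x * e)
    pull = solve-∀
    collect : ∀ k n l d p → k * n * (l * (d * p)) ≡ l * k * (p * n) * d
    collect = solve-∀

  glued : Bool → Graph (Glue.order H₁ H₂ ρ₁ ρ₂)
  glued o = Oriented.glued o

  pairs-of-copies : sum₂ (λ u v → ⟦ u <ᵇᶠ v ⟧ * D u v) ≤ copies (glued false) G + copies (glued true) G
  pairs-of-copies = begin
    sum₂ (λ u v → ⟦ u <ᵇᶠ v ⟧ * D u v)  ≡⟨ sum₂-cong (λ u v → cong (⟦ u <ᵇᶠ v ⟧ *_) (D-split u v)) ⟩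
    sum₂ (λ u v → ⟦ u <ᵇᶠ v ⟧ * (q u v + q v u))  ≤⟨ unordered-sum-≤ q ⟩
    sum₂ q  ≡⟨ sum₂-distrib-+ (pairing false) (pairing true) ⟩
    sum₂ (pairing false) + sum₂ (pairing true)
      ≤⟨ +-mono-≤ (Oriented.pairings≤copies false G) (Oriented.pairings≤copies true G) ⟩
    copies (glued false) G + copies (glued true) G ∎
    where
    pairing : Bool → Fin n → Fin n → ℕ
    pairing o = Oriented.pairings o G
    q : Fin n → Fin n → ℕ
    q u v = pairing false u v + pairing true u v
    half : Bool → Fin n → Fin n → (Fin w₂ → Fin n) → ℕ
    half o u v g = ∑M w₁ (λ g₁ → ⟦ extends H₁ G ρ₁ o u v g g₁ ⟧)
    D-split : ∀ u v → D u v ≡ q u v + q v u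
    D-split u v = begin-equality
      D u v  ≡⟨ ∑M-cong w₂ split ⟩
      ∑M w₂ (λ g → (A g + B g) + (C g + F g))  ≡⟨ ∑M-distrib-+ w₂ (λ g → A g + B g) (λ g → C g + F g) ⟩
      ∑M w₂ (λ g → A g + B g) + ∑M w₂ (λ g → C g + F g)  ≡⟨ cong₂ _+_ (∑M-distrib-+ w₂ A B) (∑M-distrib-+ w₂ C F) ⟩
      q u v + q v u ∎
      where
      -- The four orientations of the two copies. Equal ones (`A`, `C`) give the gluing `false`,
      -- opposite ones (`B`, `F`) the gluing `true`; when `H₁` is swapped (`C`, `F`) the pair is
      -- read from `v` to `u`.
      A B C F : (Fin w₂ → Fin n) → ℕ
      A g = ⟦ copy₂ false u v g ⟧ * half false u v g
      B g = ⟦ copy₂ true u v g ⟧ * half false u v g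
      C g = ⟦ copy₂ true u v g ⟧ * half true u v g
      F g = ⟦ copy₂ false u v g ⟧ * half true u v g
      expand : ∀ p q x y → (p + q) * (x + y) ≡ p * x + q * x + (q * y + p * y)
      expand = solve-∀
      split : ∀ g → multiplicity u v g * ext₁ u v g ≡ A g + B g + (C g + F g)
      split g = trans (cong (multiplicity u v g *_) (∑M-distrib-+ w₁ (λ g₁ → ⟦ extends H₁ G ρ₁ false u v g g₁ ⟧)
                                                                    (λ g₁ → ⟦ extends H₁ G ρ₁ true u v g g₁ ⟧)))
        (expand ⟦ copy₂ false u v g ⟧ ⟦ copy₂ true u v g ⟧ (half false u v g) (half true u v g))

  -- The factor 8 is 4 for the quarter of fine edges times 2 for taking the more frequent of the two
  -- gluings, which may depend on `G`.
  many-glued-copies : ∃[ o ] (m * (X₁ * X₂) ≤ 8 * (K₁ * K₂) * (copies (glued o) G * (N₁ * N₂)))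
  many-glued-copies = by-larger (≤-total c₀ c₁)
    where
    c₀ = copies (glued false) G
    c₁ = copies (glued true) G
    T = K₁ * K₂ * (N₁ * N₂)
    total : m * (X₁ * X₂) ≤ 4 * (T * (c₀ + c₁))
    total = begin
      m * (X₁ * X₂)  ≤⟨ *-monoˡ-≤ (X₁ * X₂) many-fine ⟩
      4 * sum₂ (λ u v → ⟦ fine u v ⟧) * (X₁ * X₂)  ≡⟨ *-assoc 4 (sum₂ (λ u v → ⟦ fine u v ⟧)) (X₁ * X₂) ⟩
      4 * (sum₂ (λ u v → ⟦ fine u v ⟧) * (X₁ * X₂))  ≡⟨ cong (4 *_) (sum₂-*ʳ (X₁ * X₂) (λ u v → ⟦ fine u v ⟧)) ⟨
      4 * sum₂ (λ u v → ⟦ fine u v ⟧ * (X₁ * X₂))  ≤⟨ *-monoʳ-≤ 4 (sum₂-mono step) ⟩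
      4 * sum₂ (λ u v → T * (⟦ u <ᵇᶠ v ⟧ * D u v))  ≡⟨ cong (4 *_) (sum₂-*ˡ T (λ u v → ⟦ u <ᵇᶠ v ⟧ * D u v)) ⟩
      4 * (T * sum₂ (λ u v → ⟦ u <ᵇᶠ v ⟧ * D u v))  ≤⟨ *-monoʳ-≤ 4 (*-monoʳ-≤ T pairs-of-copies) ⟩
      4 * (T * (c₀ + c₁)) ∎
      where
      swap : ∀ s t d → s * (t * d) ≡ t * (s * d)
      swap = solve-∀
      step : ∀ u v → ⟦ fine u v ⟧ * (X₁ * X₂) ≤ T * (⟦ u <ᵇᶠ v ⟧ * D u v)
      step u v = begin
        ⟦ fine u v ⟧ * (X₁ * X₂)  ≤⟨ ⟦⟧*-mono (fine u v) (fine-product u v) ⟩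
        ⟦ fine u v ⟧ * (T * D u v)  ≤⟨ *-monoˡ-≤ (T * D u v) (⟦⟧-mono (λ h →
             proj₂ (∧-true {adj G u v} (proj₁ (∧-true {E u v} h))))) ⟩
        ⟦ u <ᵇᶠ v ⟧ * (T * D u v)  ≡⟨ swap ⟦ u <ᵇᶠ v ⟧ T (D u v) ⟩
        T * (⟦ u <ᵇᶠ v ⟧ * D u v) ∎
    doubled : ∀ c → c₀ + c₁ ≤ c + c → m * (X₁ * X₂) ≤ 8 * (K₁ * K₂) * (c * (N₁ * N₂))
    doubled c le = begin
      m * (X₁ * X₂)  ≤⟨ total ⟩
      4 * (T * (c₀ + c₁))  ≤⟨ *-monoʳ-≤ 4 (*-monoʳ-≤ T le) ⟩
      4 * (T * (c + c))  ≡⟨ eight (K₁ * K₂) (N₁ * N₂) c ⟩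
      8 * (K₁ * K₂) * (c * (N₁ * N₂)) ∎
      where
      eight : ∀ k n c → 4 * (k * n * (c + c)) ≡ 8 * k * (c * n)
      eight = solve-∀
    by-larger : c₀ ≤ c₁ ⊎ c₁ ≤ c₀ → ∃[ o ] (m * (X₁ * X₂) ≤ 8 * (K₁ * K₂) * (copies (glued o) G * (N₁ * N₂)))
    by-larger (inj₁ le) = true  , doubled c₁ (+-monoˡ-≤ c₁ le)
    by-larger (inj₂ le) = false , doubled c₀ (+-monoʳ-≤ c₀ le)

-- From rational to natural constants

-- `ℕtoℚ` normalises its fraction; arithmetic on it is therefore checked on the unnormalised
-- fraction with denominator 1.
toℚᵘ-ℕtoℚ : ∀ n → toℚᵘ (ℕtoℚ n) ℚᵘ.≃ ℚᵘ.mkℚᵘ (ℤ.+ n) 0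
toℚᵘ-ℕtoℚ n = ℚₚ.toℚᵘ-fromℚᵘ (ℚᵘ.mkℚᵘ (ℤ.+ n) 0)

ℕtoℚ-* : ∀ a b → ℕtoℚ (a * b) ≡ ℕtoℚ a ℚ.* ℕtoℚ b
ℕtoℚ-* a b = ℚₚ.toℚᵘ-injective (begin-equality
  toℚᵘ (ℕtoℚ (a * b))                      ≃⟨ toℚᵘ-ℕtoℚ (a * b) ⟩
  ℚᵘ.mkℚᵘ (ℤ.+ (a * b)) 0                    ≃⟨ ℚᵘ.*≡* (cong (ℤ._* ℤ.+ 1) (ℤₚ.pos-* a b)) ⟩
  ℚᵘ.mkℚᵘ (ℤ.+ a) 0 ℚᵘ.* ℚᵘ.mkℚᵘ (ℤ.+ b) 0     ≃⟨ ℚᵘₚ.*-cong (toℚᵘ-ℕtoℚ a) (toℚᵘ-ℕtoℚ b) ⟨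
  toℚᵘ (ℕtoℚ a) ℚᵘ.* toℚᵘ (ℕtoℚ b)         ≃⟨ ℚₚ.toℚᵘ-homo-* (ℕtoℚ a) (ℕtoℚ b) ⟨
  toℚᵘ (ℕtoℚ a ℚ.* ℕtoℚ b)                 ∎)
  where open ℚᵘₚ.≤-Reasoning

ℕtoℚ-mono-≤ : ∀ {a b} → a ≤ b → ℕtoℚ a ℚ.≤ ℕtoℚ b
ℕtoℚ-mono-≤ {a} {b} a≤b = ℚₚ.toℚᵘ-cancel-≤ (begin
  toℚᵘ (ℕtoℚ a)      ≃⟨ toℚᵘ-ℕtoℚ a ⟩
  ℚᵘ.mkℚᵘ (ℤ.+ a) 0    ≤⟨ ℚᵘ.*≤* (ℤₚ.*-monoʳ-≤-nonNeg (ℤ.+ 1) (ℤ.+≤+ a≤b)) ⟩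
  ℚᵘ.mkℚᵘ (ℤ.+ b) 0    ≃⟨ toℚᵘ-ℕtoℚ b ⟨
  toℚᵘ (ℕtoℚ b)      ∎)
  where open ℚᵘₚ.≤-Reasoning

ℕtoℚ-cancel-≤ : ∀ {a b} → ℕtoℚ a ℚ.≤ ℕtoℚ b → a ≤ b
ℕtoℚ-cancel-≤ {a} {b} le = ℤₚ.drop‿+≤+ (ℤₚ.*-cancelʳ-≤-pos (ℤ.+ a) (ℤ.+ b) (ℤ.+ 1) (ℚᵘₚ.drop-*≤* (begin
  ℚᵘ.mkℚᵘ (ℤ.+ a) 0    ≃⟨ toℚᵘ-ℕtoℚ a ⟨
  toℚᵘ (ℕtoℚ a)      ≤⟨ ℚₚ.toℚᵘ-mono-≤ le ⟩
  toℚᵘ (ℕtoℚ b)      ≃⟨ toℚᵘ-ℕtoℚ b ⟩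
  ℚᵘ.mkℚᵘ (ℤ.+ b) 0    ∎)))
  where open ℚᵘₚ.≤-Reasoning

ℕtoℚ-^ : ∀ a k → ℕtoℚ (a ^ k) ≡ ℕtoℚ a ^ℚ k
ℕtoℚ-^ a zero    = refl
ℕtoℚ-^ a (suc k) = trans (ℕtoℚ-* a (a ^ k)) (cong (ℕtoℚ a ℚ.*_) (ℕtoℚ-^ a k))

ℕtoℚ-nonNeg : ∀ a → NonNegative (ℕtoℚ a)
ℕtoℚ-nonNeg a = ℚ.nonNegative (ℕtoℚ-mono-≤ {0} {a} z≤n)

ℕtoℚ-pos : ∀ a .{{_ : NonZero a}} → Positive (ℕtoℚ a)
ℕtoℚ-pos a = ℚₚ.normalize-pos a 1

*-mono-≤-nonNeg : ∀ {p q r s} → .{{NonNegative p}} → .{{NonNegative s}} → p ℚ.≤ q → r ℚ.≤ s → p ℚ.* r ℚ.≤ q ℚ.* s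
*-mono-≤-nonNeg {p} {q} {r} {s} p≤q r≤s =
  ℚₚ.≤-trans (ℚₚ.*-monoˡ-≤-nonNeg p r≤s) (ℚₚ.*-monoʳ-≤-nonNeg s p≤q)

^ℚ-nonNeg : ∀ x k → .{{NonNegative x}} → NonNegative (x ^ℚ k)
^ℚ-nonNeg x zero    = _
^ℚ-nonNeg x (suc k) = ℚₚ.nonNeg*nonNeg⇒nonNeg x (x ^ℚ k) {{^ℚ-nonNeg x k}}

^ℚ-pos : ∀ x k → .{{Positive x}} → Positive (x ^ℚ k)
^ℚ-pos x zero    = _
^ℚ-pos x (suc k) = ℚₚ.pos*pos⇒pos x (x ^ℚ k) {{^ℚ-pos x k}}

^ℚ-monoˡ-≤ : ∀ k {x y} → .{{NonNegative x}} → .{{NonNegative y}} → x ℚ.≤ y → (x ^ℚ k) ℚ.≤ (y ^ℚ k)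
^ℚ-monoˡ-≤ zero                     x≤y = ℚₚ.≤-refl
^ℚ-monoˡ-≤ (suc k) {x} {y} {{x≥0}} x≤y = *-mono-≤-nonNeg {{x≥0}} {{^ℚ-nonNeg y k}} x≤y (^ℚ-monoˡ-≤ k x≤y)

^ℚ-distribʳ-* : ∀ k x y → (x ℚ.* y) ^ℚ k ≡ (x ^ℚ k) ℚ.* (y ^ℚ k)
^ℚ-distribʳ-* zero    x y = refl
^ℚ-distribʳ-* (suc k) x y = begin
  (x ℚ.* y) ℚ.* ((x ℚ.* y) ^ℚ k)             ≡⟨ cong ((x ℚ.* y) ℚ.*_) (^ℚ-distribʳ-* k x y) ⟩
  (x ℚ.* y) ℚ.* ((x ^ℚ k) ℚ.* (y ^ℚ k))      ≡⟨ ℚₚ.*-assoc x y _ ⟩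
  x ℚ.* (y ℚ.* ((x ^ℚ k) ℚ.* (y ^ℚ k)))      ≡⟨ cong (x ℚ.*_) (ℚₚ.*-assoc y (x ^ℚ k) (y ^ℚ k)) ⟨
  x ℚ.* ((y ℚ.* (x ^ℚ k)) ℚ.* (y ^ℚ k))      ≡⟨ cong (λ z → x ℚ.* (z ℚ.* (y ^ℚ k))) (ℚₚ.*-comm y (x ^ℚ k)) ⟩
  x ℚ.* (((x ^ℚ k) ℚ.* y) ℚ.* (y ^ℚ k))      ≡⟨ cong (x ℚ.*_) (ℚₚ.*-assoc (x ^ℚ k) y (y ^ℚ k)) ⟩
  x ℚ.* ((x ^ℚ k) ℚ.* (y ℚ.* (y ^ℚ k)))      ≡⟨ ℚₚ.*-assoc x (x ^ℚ k) _ ⟨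
  (x ℚ.* (x ^ℚ k)) ℚ.* (y ℚ.* (y ^ℚ k))      ∎
  where open ≡-Reasoning

-- Multiplied by `κ^(t+1)`, the wanted inequality for each exponent `s/(t+1)` follows from the same
-- one for `C'`: the larger constant pays for the lost edges, and fewer vertices only lower the
-- threshold.
threshold-dilute : ∀ α {C C'} κ {n n' m m'} → .{{Positive C}} → .{{NonZero κ}} → ℕtoℚ κ ℚ.* C ℚ.≤ C' →
  n' ≤ n → m ≤ κ * m' → AtLeastThreshold α C' n m → AtLeastThreshold α C n' m'
threshold-dilute α {C} {C'} κ {n} {n'} {m} {m'} κC≤C' n'≤n m≤κm' dense s t 1≤s low =
  ℚₚ.*-cancelˡ-≤-pos (k ^ℚ suc t) {{^ℚ-pos k (suc t) {{ℕtoℚ-pos κ}}}} (begin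
    (k ^ℚ suc t) ℚ.* ((C ^ℚ suc t) ℚ.* (ℕtoℚ n' ^ℚ s))    ≡⟨ ℚₚ.*-assoc (k ^ℚ suc t) (C ^ℚ suc t) (ℕtoℚ n' ^ℚ s) ⟨
    ((k ^ℚ suc t) ℚ.* (C ^ℚ suc t)) ℚ.* (ℕtoℚ n' ^ℚ s)    ≡⟨ cong (ℚ._* (ℕtoℚ n' ^ℚ s)) (^ℚ-distribʳ-* (suc t) k C) ⟨
    ((k ℚ.* C) ^ℚ suc t) ℚ.* (ℕtoℚ n' ^ℚ s)
      ≤⟨ *-mono-≤-nonNeg {{^ℚ-nonNeg (k ℚ.* C) (suc t) {{kC≥0}}}} {{^ℚ-nonNeg (ℕtoℚ n) s {{ℕtoℚ-nonNeg n}}}}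
           (^ℚ-monoˡ-≤ (suc t) {{kC≥0}} {{C'≥0}} κC≤C')
           (^ℚ-monoˡ-≤ s {{ℕtoℚ-nonNeg n'}} {{ℕtoℚ-nonNeg n}} (ℕtoℚ-mono-≤ n'≤n)) ⟩
    (C' ^ℚ suc t) ℚ.* (ℕtoℚ n ^ℚ s)                        ≤⟨ dense s t 1≤s low ⟩
    ℕtoℚ m ^ℚ suc t
      ≤⟨ ^ℚ-monoˡ-≤ (suc t) {{ℕtoℚ-nonNeg m}} {{ℕtoℚ-nonNeg (κ * m')}} (ℕtoℚ-mono-≤ m≤κm') ⟩
    ℕtoℚ (κ * m') ^ℚ suc t                                 ≡⟨ cong (_^ℚ suc t) (ℕtoℚ-* κ m') ⟩
    (k ℚ.* ℕtoℚ m') ^ℚ suc t                               ≡⟨ ^ℚ-distribʳ-* (suc t) k (ℕtoℚ m') ⟩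
    (k ^ℚ suc t) ℚ.* (ℕtoℚ m' ^ℚ suc t)                    ∎)
  where
  open ℚₚ.≤-Reasoning
  k = ℕtoℚ κ
  kC≥0 : NonNegative (k ℚ.* C)
  kC≥0 = ℚₚ.nonNeg*nonNeg⇒nonNeg k {{ℕtoℚ-nonNeg κ}} C {{ℚₚ.pos⇒nonNeg C}}
  C'≥0 : NonNegative C'
  C'≥0 = ℚ.nonNegative (ℚₚ.≤-trans (ℚₚ.nonNegative⁻¹ (k ℚ.* C) {{kC≥0}}) κC≤C')

-- A positive fraction times its denominator is its numerator, a positive integer.
1≤denominator* : ∀ β → .{{Positive β}} → 1ℚ ℚ.≤ ℕtoℚ (ℚ.denominatorℕ β) ℚ.* β
1≤denominator* β@(mkℚ (ℤ.+ suc p) q _) = ℚₚ.toℚᵘ-cancel-≤ (begin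
  ℚᵘ.1ℚᵘ                                                  ≤⟨ ℚᵘ.*≤* (ℤ.+≤+ le) ⟩
  ℚᵘ.mkℚᵘ (ℤ.+ suc q) 0 ℚᵘ.* ℚᵘ.mkℚᵘ (ℤ.+ suc p) q            ≃⟨ ℚᵘₚ.*-congʳ (toℚᵘ-ℕtoℚ (suc q)) ⟨
  toℚᵘ (ℕtoℚ (suc q)) ℚᵘ.* toℚᵘ β                         ≃⟨ ℚₚ.toℚᵘ-homo-* (ℕtoℚ (suc q)) β ⟨
  toℚᵘ (ℕtoℚ (suc q) ℚ.* β)                               ∎)
  where
  open ℚᵘₚ.≤-Reasoning
  le : 1 * suc (q + 0) ≤ (suc q * suc p) * 1
  le = subst₂ _≤_ (trans (*-identityʳ (suc q)) (trans (sym (+-identityʳ (suc q))) (sym (*-identityˡ _)))) (sym (*-identityʳ (suc q * suc p)))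
         (*-monoʳ-≤ (suc q) {1} {suc p} (s≤s z≤n))

-- Reads ManyCopies in ℕ, the constant β being replaced by the reciprocal of a natural number.
manyCopies⇒ℕ : ∀ β → .{{Positive β}} → ∀ e v n m c → ManyCopies β e v n m c →
  m ^ e * n ^ v ≤ ℚ.denominatorℕ β * (c * n ^ (2 * e))
manyCopies⇒ℕ β e v n m c h = ℕtoℚ-cancel-≤ (begin
  ℕtoℚ (m ^ e * n ^ v)        ≡⟨ ℚₚ.*-identityˡ _ ⟨
  1ℚ ℚ.* ℕtoℚ (m ^ e * n ^ v)
    ≤⟨ ℚₚ.*-monoʳ-≤-nonNeg (ℕtoℚ (m ^ e * n ^ v)) {{ℕtoℚ-nonNeg (m ^ e * n ^ v)}} (1≤denominator* β) ⟩
  (B ℚ.* β) ℚ.* ℕtoℚ (m ^ e * n ^ v)  ≡⟨ ℚₚ.*-assoc B β _ ⟩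
  B ℚ.* (β ℚ.* ℕtoℚ (m ^ e * n ^ v))
    ≡⟨ cong (λ z → B ℚ.* (β ℚ.* z)) (trans (ℕtoℚ-* (m ^ e) (n ^ v)) (cong₂ ℚ._*_ (ℕtoℚ-^ m e) (ℕtoℚ-^ n v))) ⟩
  B ℚ.* (β ℚ.* ((ℕtoℚ m ^ℚ e) ℚ.* (ℕtoℚ n ^ℚ v)))  ≡⟨ cong (B ℚ.*_) (ℚₚ.*-assoc β _ _) ⟨
  B ℚ.* ((β ℚ.* (ℕtoℚ m ^ℚ e)) ℚ.* (ℕtoℚ n ^ℚ v))
    ≤⟨ ℚₚ.*-monoˡ-≤-nonNeg B {{ℕtoℚ-nonNeg (ℚ.denominatorℕ β)}} h ⟩
  B ℚ.* (ℕtoℚ c ℚ.* (ℕtoℚ n ^ℚ (2 * e)))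
    ≡⟨ cong (B ℚ.*_) (trans (ℕtoℚ-* c (n ^ (2 * e))) (cong (ℕtoℚ c ℚ.*_) (ℕtoℚ-^ n (2 * e)))) ⟨
  B ℚ.* ℕtoℚ (c * n ^ (2 * e))  ≡⟨ ℕtoℚ-* (ℚ.denominatorℕ β) (c * n ^ (2 * e)) ⟨
  ℕtoℚ (ℚ.denominatorℕ β * (c * n ^ (2 * e))) ∎)
  where
  open ℚₚ.≤-Reasoning
  B = ℕtoℚ (ℚ.denominatorℕ β)

1/ℕ : (b : ℕ) → .{{NonZero b}} → ℚ
1/ℕ b = (ℚ.1/ ℕtoℚ b) {{ℚₚ.pos⇒nonZero (ℕtoℚ b) {{ℕtoℚ-pos b}}}}

1/ℕ-pos : ∀ b → .{{_ : NonZero b}} → Positive (1/ℕ b)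
1/ℕ-pos b = ℚₚ.1/pos⇒pos (ℕtoℚ b) {{ℕtoℚ-pos b}}

ℕ⇒manyCopies : ∀ b → .{{_ : NonZero b}} → ∀ e v n m c → m ^ e * n ^ v ≤ b * (c * n ^ (2 * e)) →
  ManyCopies (1/ℕ b) e v n m c
ℕ⇒manyCopies b e v n m c h = begin
  (β ℚ.* (ℕtoℚ m ^ℚ e)) ℚ.* (ℕtoℚ n ^ℚ v)  ≡⟨ ℚₚ.*-assoc β _ _ ⟩
  β ℚ.* ((ℕtoℚ m ^ℚ e) ℚ.* (ℕtoℚ n ^ℚ v))
    ≡⟨ cong (β ℚ.*_) (trans (ℕtoℚ-* (m ^ e) (n ^ v)) (cong₂ ℚ._*_ (ℕtoℚ-^ m e) (ℕtoℚ-^ n v))) ⟨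
  β ℚ.* ℕtoℚ (m ^ e * n ^ v)
    ≤⟨ ℚₚ.*-monoˡ-≤-nonNeg β {{ℚₚ.pos⇒nonNeg β {{1/ℕ-pos b}}}} (ℕtoℚ-mono-≤ h) ⟩
  β ℚ.* ℕtoℚ (b * (c * n ^ (2 * e)))  ≡⟨ cong (β ℚ.*_) (ℕtoℚ-* b (c * n ^ (2 * e))) ⟩
  β ℚ.* (ℕtoℚ b ℚ.* ℕtoℚ (c * n ^ (2 * e)))  ≡⟨ ℚₚ.*-assoc β (ℕtoℚ b) _ ⟨
  (β ℚ.* ℕtoℚ b) ℚ.* ℕtoℚ (c * n ^ (2 * e))
    ≡⟨ cong (ℚ._* ℕtoℚ (c * n ^ (2 * e))) (ℚₚ.*-inverseˡ (ℕtoℚ b) {{ℚₚ.pos⇒nonZero (ℕtoℚ b) {{ℕtoℚ-pos b}}}}) ⟩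
  1ℚ ℚ.* ℕtoℚ (c * n ^ (2 * e))  ≡⟨ ℚₚ.*-identityˡ _ ⟩
  ℕtoℚ (c * n ^ (2 * e))  ≡⟨ trans (ℕtoℚ-* c (n ^ (2 * e))) (cong (ℕtoℚ c ℚ.*_) (ℕtoℚ-^ n (2 * e))) ⟩
  ℕtoℚ c ℚ.* (ℕtoℚ n ^ℚ (2 * e)) ∎
  where
  open ℚₚ.≤-Reasoning
  β = 1/ℕ b

-- The identified edge contributes the single factor `m`. Multiplying by `n²` restores its two
-- vertices on the left and its share of `n^(2e)` on the right.
multiply-out : ∀ m n e₁ e₂ w₁ w₂ K c →
  m * (m ^ e₁ * n ^ w₁ * (m ^ e₂ * n ^ w₂)) ≤ K * (c * (n ^ (2 * e₁) * n ^ (2 * e₂))) →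
  m ^ (suc e₁ + suc e₂ ∸ 1) * n ^ ((2 + w₁) + (2 + w₂) ∸ 2) ≤ suc K * (c * n ^ (2 * (suc e₁ + suc e₂ ∸ 1)))
multiply-out m n e₁ e₂ w₁ w₂ K c h = begin
  m ^ (e₁ + suc e₂) * n ^ (w₁ + (2 + w₂))
    ≡⟨ cong₂ _*_ (^-distribˡ-+-* m e₁ (suc e₂)) (^-distribˡ-+-* n w₁ (2 + w₂)) ⟩
  m ^ e₁ * (m * m ^ e₂) * (n ^ w₁ * (n * (n * n ^ w₂)))
    ≡⟨ gather m n (m ^ e₁) (m ^ e₂) (n ^ w₁) (n ^ w₂) ⟩
  m * (m ^ e₁ * n ^ w₁ * (m ^ e₂ * n ^ w₂)) * (n * n)  ≤⟨ *-monoˡ-≤ (n * n) h ⟩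
  K * (c * (n ^ (2 * e₁) * n ^ (2 * e₂))) * (n * n)  ≡⟨ spread-out K c (n ^ (2 * e₁)) (n ^ (2 * e₂)) n ⟩
  K * (c * (n ^ (2 * e₁) * (n * (n * n ^ (2 * e₂)))))  ≡⟨ cong (λ z → K * (c * z)) (^-distribˡ-+-* n (2 * e₁) (2 + 2 * e₂)) ⟨
  K * (c * n ^ (2 * e₁ + (2 + 2 * e₂)))  ≡⟨ cong (λ i → K * (c * n ^ i)) (exponent e₁ e₂) ⟩
  -- `K` may be 0, whereas the final β is a reciprocal; hence `suc K`.
  K * (c * n ^ (2 * (e₁ + suc e₂)))  ≤⟨ m≤n+m _ (c * n ^ (2 * (e₁ + suc e₂))) ⟩
  suc K * (c * n ^ (2 * (e₁ + suc e₂))) ∎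
  where
  open ≤-Reasoning
  gather : ∀ m n a b x y → a * (m * b) * (x * (n * (n * y))) ≡ m * (a * x * (b * y)) * (n * n)
  gather = solve-∀
  spread-out : ∀ k c x y n → k * (c * (x * y)) * (n * n) ≡ k * (c * (x * (n * (n * y))))
  spread-out = solve-∀
  exponent : ∀ a b → 2 * a + (2 + 2 * b) ≡ 2 * (a + (1 + b))
  exponent = solve-∀

-- Choice of the constants and the theorem

dilution-nonZero : ∀ k → NonZero (dilution k)
dilution-nonZero k = m*n≢0 4 (density k) {{_}} {{density-nonZero k}}

module Assembly (α : Real01) {v₁ v₂ : ℕ} (H₁ : Graph v₁) (H₂ : Graph v₂)
  {a₁ b₁ : Fin v₁} (ab₁ : adj H₁ a₁ b₁ ≡ true) {a₂ b₂ : Fin v₂} (ab₂ : adj H₂ a₂ b₂ ≡ true)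
  (ρ₁ : Rooting a₁ b₁) (ρ₂ : Rooting a₂ b₂)
  (e₁ e₂ : ℕ) (edges₁ : edges H₁ ≡ suc e₁) (edges₂ : edges H₂ ≡ suc e₂)
  (C₁ C₂ : ℚ) (C₁>0 : Positive C₁) (C₂>0 : Positive C₂) (B₁ B₂ : ℕ)
  (many₁ : ∀ n (G : Graph n) → AtLeastThreshold α C₁ n (edges G) →
           edges G ^ edges H₁ * n ^ v₁ ≤ B₁ * (copies H₁ G * n ^ (2 * edges H₁)))
  (many₂ : ∀ n (G : Graph n) → AtLeastThreshold α C₂ n (edges G) →
           edges G ^ edges H₂ * n ^ v₂ ≤ B₂ * (copies H₂ G * n ^ (2 * edges H₂)))
  where
  open Rooting ρ₁ using () renaming (rest to w₁; size to size₁)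
  open Rooting ρ₂ using () renaming (rest to w₂; size to size₂)
  open Glue H₁ H₂ ρ₁ ρ₂ using (module Oriented)

  κ₁ κ₂ K₁ K₂ K : ℕ
  -- Copies of `H₁` have to avoid the `w₂` free vertices of a copy of `H₂`; copies of `H₂` avoid
  -- nothing.
  κ₁ = dilution w₂
  κ₂ = dilution 0
  K₁ = spread H₁ ab₁ ρ₁ e₁ edges₁ (AtLeastThreshold α C₁) B₁ many₁ κ₁
  K₂ = spread H₂ ab₂ ρ₂ e₂ edges₂ (AtLeastThreshold α C₂) B₂ many₂ κ₂
  K  = 8 * (K₁ * K₂)

  summand : ℕ → ℚ → ℚ
  summand κ C = ℕtoℚ κ ℚ.* C

  summand-pos : ∀ κ C → .{{NonZero κ}} → Positive C → Positive (summand κ C)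
  summand-pos κ C C>0 = ℚₚ.pos*pos⇒pos (ℕtoℚ κ) {{ℕtoℚ-pos κ}} C {{C>0}}

  s₁>0 : Positive (summand κ₁ C₁)
  s₁>0 = summand-pos κ₁ C₁ {{dilution-nonZero w₂}} C₁>0

  s₂>0 : Positive (summand κ₂ C₂)
  s₂>0 = summand-pos κ₂ C₂ {{dilution-nonZero 0}} C₂>0

  -- A sum of positive numbers in place of their maximum: each summand is the constant that one of
  -- the two dilutions requires.
  C : ℚ
  C = summand κ₁ C₁ ℚ.+ summand κ₂ C₂

  C>0 : 0ℚ ℚ.< C
  C>0 = ℚₚ.positive⁻¹ C {{ℚₚ.pos+pos⇒pos (summand κ₁ C₁) {{s₁>0}} (summand κ₂ C₂) {{s₂>0}}}}

  s₁≤C : summand κ₁ C₁ ℚ.≤ C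
  s₁≤C = subst (ℚ._≤ C) (ℚₚ.+-identityʳ (summand κ₁ C₁))
    (ℚₚ.+-mono-≤ (ℚₚ.≤-refl {summand κ₁ C₁}) (ℚₚ.<⇒≤ (ℚₚ.positive⁻¹ (summand κ₂ C₂) {{s₂>0}})))

  s₂≤C : summand κ₂ C₂ ℚ.≤ C
  s₂≤C = subst (ℚ._≤ C) (ℚₚ.+-identityˡ (summand κ₂ C₂))
    (ℚₚ.+-mono-≤ (ℚₚ.<⇒≤ (ℚₚ.positive⁻¹ (summand κ₁ C₁) {{s₁>0}})) (ℚₚ.≤-refl {summand κ₂ C₂}))

  module _ (n : ℕ) (G : Graph n) (dense : AtLeastThreshold α C n (edges G)) where
    dense₁ : ∀ {n' m'} → n' ≤ n → edges G ≤ κ₁ * m' → AtLeastThreshold α C₁ n' m'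
    dense₁ {n'} {m'} n'≤n m≤ =
      threshold-dilute α κ₁ {n} {n'} {edges G} {m'} {{C₁>0}} {{dilution-nonZero w₂}} s₁≤C n'≤n m≤ dense

    dense₂ : ∀ {n' m'} → n' ≤ n → edges G ≤ κ₂ * m' → AtLeastThreshold α C₂ n' m'
    dense₂ {n'} {m'} n'≤n m≤ =
      threshold-dilute α κ₂ {n} {n'} {edges G} {m'} {{C₂>0}} {{dilution-nonZero 0}} s₂≤C n'≤n m≤ dense

    Many : Bool → Set
    Many o = edges G * (edges G ^ e₁ * n ^ w₁ * (edges G ^ e₂ * n ^ w₂)) ≤
             K * (copies (Oriented.glued o) G * (n ^ (2 * e₁) * n ^ (2 * e₂)))

    -- Without edges the leading factor `edges G` makes the left side 0; the averaging arguments
    -- need at least one edge.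
    some-orientation : ∃[ o ] Many o
    some-orientation = by-edges (edges G ≟ 0)
      where
      by-edges : Dec (edges G ≡ 0) → ∃[ o ] Many o
      by-edges (yes none) = false , ≤-trans
        (≤-reflexive (cong (_* (edges G ^ e₁ * n ^ w₁ * (edges G ^ e₂ * n ^ w₂))) none)) z≤n
      by-edges (no some) = Counting.many-glued-copies H₁ H₂ ρ₁ ρ₂ G e₁ e₂ K₁ K₂
        (λ P S edge avoid large → robust-edge H₁ ab₁ ρ₁ e₁ edges₁ (AtLeastThreshold α C₁) B₁ many₁
           G P S dense₁ (n≢0⇒n>0 some) edge avoid large)
        (λ P S edge avoid large → robust-edge H₂ ab₂ ρ₂ e₂ edges₂ (AtLeastThreshold α C₂) B₂ many₂
           G P S dense₂ (n≢0⇒n>0 some) edge avoid large)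

    gluing : Σ ℕ (λ m → Σ (Graph m) (λ K' → IsGluing H₁ H₂ a₁ b₁ a₂ b₂ K' ×
      ManyCopies (1/ℕ (suc K)) (edges H₁ + edges H₂ ∸ 1) (v₁ + v₂ ∸ 2) n (edges G) (copies K' G)))
    gluing = package some-orientation
      where
      package : ∃[ o ] Many o → _
      package (o , many) = _ , Oriented.glued o , Oriented.isGluing o ,
        ℕ⇒manyCopies (suc K) (edges H₁ + edges H₂ ∸ 1) (v₁ + v₂ ∸ 2) n (edges G) (copies (Oriented.glued o) G)
          (subst₂ (λ e v → edges G ^ e * n ^ v ≤ suc K * (copies (Oriented.glued o) G * n ^ (2 * e)))
            (sym (cong₂ (λ p q → p + q ∸ 1) edges₁ edges₂)) (sym (cong₂ (λ p q → p + q ∸ 2) size₁ size₂))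
            (multiply-out (edges G) n e₁ e₂ w₁ w₂ K (copies (Oriented.glued o) G) many))

theorem1p9 : (α : Real01) → ∀ {v₁ v₂} (H₁ : Graph v₁) (H₂ : Graph v₂) →
    Bipartite H₁ → Bipartite H₂ → ESGood α H₁ → ESGood α H₂ →
    (a₁ b₁ : Fin v₁) → adj H₁ a₁ b₁ ≡ true →
    (a₂ b₂ : Fin v₂) → adj H₂ a₂ b₂ ≡ true →
    ∃[ C ] ∃[ β ] (0ℚ ℚ.< C × 0ℚ ℚ.< β ×
      (∀ n (G : Graph n) → AtLeastThreshold α C n (edges G) →
        Σ ℕ (λ m → Σ (Graph m) (λ K → IsGluing H₁ H₂ a₁ b₁ a₂ b₂ K ×
          ManyCopies β (edges H₁ + edges H₂ ∸ 1) (v₁ + v₂ ∸ 2) n (edges G) (copies K G)))))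
theorem1p9 α {v₁} {v₂} H₁ H₂ _ _ (C₁ , β₁ , C₁>0 , β₁>0 , good₁) (C₂ , β₂ , C₂>0 , β₂>0 , good₂) a₁ b₁ ab₁ a₂ b₂ ab₂ =
  C , 1/ℕ (suc K) , C>0 , ℚₚ.positive⁻¹ (1/ℕ (suc K)) {{1/ℕ-pos (suc K)}} , gluing
  where
  predecessor : ∀ {k} → 0 < k → k ≡ suc (k ∸ 1)
  predecessor (s≤s _) = refl
  open Assembly α H₁ H₂ ab₁ ab₂ (rooting (adj⇒≢ H₁ ab₁)) (rooting (adj⇒≢ H₂ ab₂))
    (edges H₁ ∸ 1) (edges H₂ ∸ 1) (predecessor (edge⇒edges>0 H₁ ab₁)) (predecessor (edge⇒edges>0 H₂ ab₂))
    C₁ C₂ (ℚ.positive C₁>0) (ℚ.positive C₂>0) (ℚ.denominatorℕ β₁) (ℚ.denominatorℕ β₂)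
    (λ n G d → manyCopies⇒ℕ β₁ {{ℚ.positive β₁>0}} (edges H₁) v₁ n (edges G) (copies H₁ G) (good₁ n G d))
    (λ n G d → manyCopies⇒ℕ β₂ {{ℚ.positive β₂>0}} (edges H₂) v₂ n (edges G) (copies H₂ G) (good₂ n G d))
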